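{- Let $M$ be a matroid on a ground set with $n$ elements and let $C$ be a circuit of $M$. Then the sequence $\beta_C(1),\beta_C(2),\dots,\beta_C(n)$ of timed winning probabilities is log-concave.
   Context: Matroid bingo: let $M$ be a matroid on a finite set $E$ with $|E|=n$ and circuit set $\mathcal{C}$. The elements of $E$ are called out one at a time in a uniformly random order $\sigma(1),\sigma(2),\dots,\sigma(n)$ (a uniformly random permutation of $E$). A circuit $C$ wins in round $t$ if $C\subseteq\{\sigma(1),\dots,\sigma(t)\}$ and no circuit of $M$ is contained in $\{\sigma(1),\dots,\sigma(t-1)\}$; thus the winner is the first circuit to be completed (the circuit axioms guarantee that there is no tie). $\beta_C(t)$ denotes the probability that $C$ wins in round $t$ ($1\le t\le n$). A sequence $a_1,\dots,a_n$ of real numbers is log-concave if $a_i^2\ge a_{i-1}a_{i+1}$ for every $2\le i\le n-1$. -}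

module Defs where

open import Data.Fin.Base using (Fin; zero; suc; toℕ; punchIn)
open import Data.Fin.Permutation as Perm
  using (Permutation′; _⟨$⟩ʳ_; _⟨$⟩ˡ_; _≈_; insert; remove)
open import Data.Fin.Properties using (punchIn-injective)
open import Data.Fin.Subset
  using (Subset; ⊥; _∈_; _⊆_; _∪_; _-_)
open import Data.Fin.Subset.Properties using (_⊆?_; anySubset?)
open import Data.Integer.Base using (+_)
open import Data.List.Base
  using (List; []; _∷_; [_]; length; map; filter; allFin; cartesianProductWith)
open import Data.List.Membership.Propositional.Properties using (∈-allFin)
open import Data.List.Properties using (length-++; length-map; length-tabulate)
open import Data.List.Relation.Unary.Any as Any using (Any; here; there)
open import Data.List.Relation.Unary.Any.Properties using (cartesianProductWith⁺)
import Data.List.Relation.Unary.Unique.Setoid as UniqueSetoid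
import Data.List.Relation.Unary.Unique.Setoid.Properties as UniqueSetoidₚ
open import Data.List.Relation.Unary.Unique.Propositional.Properties using (allFin⁺)
import Data.List.Relation.Unary.AllPairs as AllPairs
import Data.List.Relation.Unary.All as All
open import Data.Nat.Base using (ℕ; zero; suc; pred; NonZero; _!; _+_; _*_; _≤_)
open import Data.Nat.Properties using (_<?_; _!≢0)
open import Data.Product.Base using (∃-syntax; _×_; _,_)
import Data.Rational.Base as ℚ
open ℚ using (ℚ)
open import Data.Vec.Base using (tabulate)
open import Level using (0ℓ)
open import Relation.Binary.Bundles using (Setoid)
open import Relation.Binary.PropositionalEquality
  using (_≡_; _≢_; refl; sym; trans; cong; cong₂; subst; setoid)
open import Relation.Nullary using (¬_; does; ¬?; _×-dec_)
open import Relation.Unary using (Pred; Decidable)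

-- Matroids on Fin n given by the circuit axioms; `circuit?` is automatic
-- classically and is what lets winning orderings be counted.
record Matroid (n : ℕ) : Set₁ where
  field
    Circuit      : Pred (Subset n) 0ℓ
    circuit?     : Decidable Circuit
    ⊥-nonCircuit : ¬ Circuit ⊥
    incomparable : ∀ {C D} → Circuit C → Circuit D → C ⊆ D → C ≡ D
    elimination  : ∀ {C D e} → Circuit C → Circuit D → C ≢ D → e ∈ C → e ∈ D →
                   ∃[ B ] (Circuit B × B ⊆ (C ∪ D) - e)

permutations : ∀ n → List (Permutation′ n)
permutations zero    = [ Perm.id ]
permutations (suc n) =
  cartesianProductWith (insert zero) (allFin (suc n)) (permutations n)

length-cartesianProductWith : ∀ {A B C : Set} (f : A → B → C) xs ys →
  length (cartesianProductWith f xs ys) ≡ length xs * length ys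
length-cartesianProductWith f []       ys = refl
length-cartesianProductWith f (x ∷ xs) ys =
  trans (length-++ (map (f x) ys))
        (cong₂ _+_ (length-map (f x) ys) (length-cartesianProductWith f xs ys))

length-permutations : ∀ n → length (permutations n) ≡ n !
length-permutations zero    = refl
length-permutations (suc n) =
  trans (length-cartesianProductWith (insert zero) (allFin (suc n)) (permutations n))
        (cong₂ _*_ (length-tabulate {n = suc n} (λ i → i)) (length-permutations n))

length-permutations≢0 : ∀ n → NonZero (length (permutations n))
length-permutations≢0 n = subst NonZero (sym (length-permutations n)) (n !≢0)

-- `permutations n` meets every class of `_≈_` exactly once, so counting along
-- it is the uniform measure on orderings.

permutations-complete : ∀ {n} (π : Permutation′ n) → Any (_≈ π) (permutations n)
permutations-complete {zero}  π = here λ ()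
permutations-complete {suc n} π =
  cartesianProductWith⁺ (insert zero)
    (λ { {x} {ρ} refl ρ≈ → insert-≈ {ρ} ρ≈ })
    (Any.map sym (∈-allFin (π ⟨$⟩ʳ zero)))
    (permutations-complete (remove zero π))
  where
  insert-≈ : ∀ {ρ : Permutation′ n} → ρ ≈ remove zero π →
             insert zero (π ⟨$⟩ʳ zero) ρ ≈ π
  insert-≈ ρ≈ zero    = refl
  insert-≈ ρ≈ (suc k) =
    trans (cong (punchIn (π ⟨$⟩ʳ zero)) (ρ≈ k)) (Perm.insert-remove zero π (suc k))

permutationSetoid : ℕ → Setoid 0ℓ 0ℓ
permutationSetoid n = record
  { Carrier       = Permutation′ n
  ; _≈_           = _≈_
  ; isEquivalence = record
    { refl  = λ _ → refl
    ; sym   = λ p i → sym (p i)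
    ; trans = λ p q i → trans (p i) (q i)
    }
  }

permutations-unique : ∀ n → UniqueSetoid.Unique (permutationSetoid n) (permutations n)
permutations-unique zero    = All.[] AllPairs.∷ AllPairs.[]
permutations-unique (suc n) =
  UniqueSetoidₚ.cartesianProductWith⁺
    (setoid (Fin (suc n))) (permutationSetoid n) (permutationSetoid (suc n))
    (insert zero)
    (λ {w} {x} {π} {ρ} eq → eq zero , insert-injective {w} {x} {π} {ρ} eq)
    (allFin⁺ (suc n)) (permutations-unique n)
  where
  insert-injective : ∀ {w x} {π ρ : Permutation′ n} →
                     insert zero w π ≈ insert zero x ρ → π ≈ ρ
  insert-injective {w} {x} {π} {ρ} eq k = punchIn-injective x _ _
    (trans (cong (λ j → punchIn j (π ⟨$⟩ʳ k)) (sym (eq zero))) (eq (suc k)))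

probability : ∀ {n} {P : Pred (Permutation′ n) 0ℓ} → Decidable P → ℚ
probability {n} P? =
  + length (filter P? (permutations n)) ℚ./ length (permutations n)
  where instance _ = length-permutations≢0 n

-- The elements called in rounds 1, …, t. The ordering σ sends the 0-based
-- position i to the element called in round i + 1.
called : ∀ {n} → Permutation′ n → ℕ → Subset n
called σ t = tabulate λ e → does (toℕ (σ ⟨$⟩ˡ e) <? t)

module _ {n} (M : Matroid n) where
  open Matroid M

  WinsInRound : Subset n → ℕ → Pred (Permutation′ n) 0ℓ
  WinsInRound C t σ =
    C ⊆ called σ t × ¬ (∃[ D ] (Circuit D × D ⊆ called σ (pred t)))

  winsInRound? : ∀ C t → Decidable (WinsInRound C t)
  winsInRound? C t σ =
    (C ⊆? called σ t) ×-dec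
    ¬? (anySubset? λ D → circuit? D ×-dec (D ⊆? called σ (pred t)))

  β : Subset n → ℕ → ℚ
  β C t = probability (winsInRound? C t)

-- For sequences a 1, …, a n; the values outside this range are irrelevant.
LogConcave : ℕ → (ℕ → ℚ) → Set
LogConcave n a =
  ∀ i → 2 ≤ i → i ≤ pred n → a (pred i) ℚ.* a (suc i) ℚ.≤ a i ℚ.* a i

{-# OPTIONS --safe #-}

{-
When C wins through its element e, the set called before is independent and
contains C − e; removing C − e from it leaves an independent set of M / C.
Writing f k for the number of k-element independent sets of M / C, this gives
β_C(t) = |C| (t − 1)! (n − t)! f(t − |C|) / n!.  The log-concavity of β_C thus
follows from the strongest form of Mason's conjecture for M / C,
f(k)² ≥ (1 + 1/k) (1 + 1/(m − k)) f(k − 1) f(k + 1) with m = n − |C|, and for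
|C| = 1 the two are equivalent.

Mason's inequality is a reverse Cauchy–Schwarz inequality for a Hessian q that
is attached to every contraction of the matroid.  By Euler's formula q is the
sum of the Hessians of the contractions by one element, and if D is the diagonal
of row sums, the induction hypothesis for these yields q ≤ q D⁻¹ q.  The largest
eigenvalue of D⁻¹ q is 1, and it is simple by connectivity, so all others are
≤ 0.  Over ℤ eigenvalues are avoided: a vector v with q(v, 1) = 0 is, up to
scaling, u − D⁻¹ q u for the solution u of a Laplacian system, and then
q(v, v) = [q(u, u) − |D⁻¹ q u|²] + [q(t, t) − |t|²] with t = D⁻¹ q u and
|t|² = Σ D t², where both brackets are ≤ 0.
-}

module Submission where

open import Defs
import Algebra.Properties.Semiring.Sum as SemiringSum
open import Data.Bool.Base using (true; false; if_then_else_)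
open import Data.Fin.Base as Fin using (Fin; zero; suc; toℕ; fromℕ<; punchIn)
open import Data.Fin.Permutation using (Permutation′; _⟨$⟩ʳ_; _⟨$⟩ˡ_; insert; inverseʳ; inverseˡ)
open import Data.Fin.Properties
  using (_≟_; any?; all?; ≤-antisym; toℕ-fromℕ<; punchIn-injective; punchInᵢ≢i)
open import Data.Fin.Subset using (Subset; _∪_)
  renaming (_∈_ to _∈ˢ_; _∉_ to _∉ˢ_; _-_ to _-ˢ_)
open import Data.Fin.Subset.Properties
  using (anySubset?; nonempty?; Empty-unique; x∈p∪q⁻; p─q⊆p)
  renaming (_∈?_ to _∈ˢ?_)
import Data.Integer.Base as Int
open Int using (ℤ; 0ℤ; 1ℤ; -1ℤ; _≤_; _<_; positive; nonNegative)
import Data.Integer.Properties as ℤ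
open import Data.List.Base as List
  using (List; []; _∷_; [_]; _++_; length; map; reverse; take; filter; allFin; cartesianProductWith)
import Data.List.Membership.DecPropositional as DecMembership
open import Data.List.Membership.Propositional using (_∈_; _∉_)
open import Data.List.Membership.Propositional.Properties
  using (∈-++⁺ʳ; ∈-++⁺ˡ; ∈-++⁻; ∈-map⁻; ∈-allFin; ∈-filter⁺; ∈-filter⁻)
open import Data.List.Membership.Propositional.Properties.WithK using (unique∧set⇒bag)
open import Data.List.Properties
  using (++-identityʳ; unfold-reverse; take-map; reverse-map; map-tabulate; take-suc-tabulate; reverse-++)
open import Data.List.Relation.Binary.BagAndSetEquality using (∼bag⇒↭)
open import Data.List.Relation.Binary.Permutation.Propositional
  using (_↭_; prep; swap; ↭-refl; ↭-sym; ↭-trans; ↭⇒↭ₛ)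
open import Data.List.Relation.Binary.Permutation.Propositional.Properties
  using (shift; ∈-resp-↭; ↭-length; ++⁺ˡ)
import Data.List.Relation.Binary.Permutation.Setoid.Properties as ↭ₛ
open import Data.List.Relation.Unary.All as All using (All; []; _∷_)
open import Data.List.Relation.Unary.All.Properties using (¬Any⇒All¬)
open import Data.List.Relation.Unary.AllPairs using ([]; _∷_)
open import Data.List.Relation.Unary.Any using (here; there)
open import Data.List.Relation.Unary.Any.Properties using (reverse⁺; reverse⁻)
import Data.List.Relation.Unary.Unique.DecPropositional as DecUnique
open import Data.List.Relation.Unary.Unique.Propositional using (Unique)
open import Data.List.Relation.Unary.Unique.Propositional.Properties
  using (Unique[x∷xs]⇒x∉xs; allFin⁺; filter⁺; map⁺; map⁻)
open import Data.Maybe.Base using (just; nothing)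
open import Data.Nat.Base as ℕ using (ℕ; zero; suc; z≤n; s≤s; _!)
import Data.Nat.Properties as ℕ
open import Data.Product.Base using (∃; ∃-syntax; _×_; _,_; proj₁; proj₂)
import Data.Rational.Base as ℚ
import Data.Rational.Properties as ℚ
open import Data.Rational.Unnormalised.Base as ℚᵘ using (mkℚᵘ; *≤*)
import Data.Rational.Unnormalised.Properties as ℚᵘ
open import Data.Sum.Base using (_⊎_; inj₁; inj₂; [_,_]′)
open import Data.Vec.Base as Vec using (_∷_)
open import Data.Vec.Properties using ([]=⇒lookup; lookup⇒[]=; lookup∘tabulate)
open import Function.Base using (_∘_)
open import Function.Bundles using (mk⇔)
open import Level using (0ℓ)
open import Relation.Binary.PropositionalEquality hiding ([_])
open import Relation.Nullary
open import Relation.Nullary.Decidable using (decidable-stable)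
open import Relation.Unary using (Decidable)
open import Tactic.RingSolver using (solve-∀)
open import Tactic.RingSolver.Core.AlmostCommutativeRing
  using (AlmostCommutativeRing; fromCommutativeRing)

-- Independent sets are counted as ordered tuples: for independent `s`, `F k s` is `k !` times the
-- number of independent k-sets of the contraction by `s`. Contraction is then mere prefixing, and
-- the factor 1 + 1/k of Mason's inequality is absorbed, which leaves (N + 1) F(k) F(k + 2) ≤ N F(k
-- + 1)². The parameter N stays fixed along the induction on k, in which each contraction lowers k
-- by one. It is tied to the matroid only at k = 0, where at most N + 1 elements are left to be
-- nonloops; the remaining factor 1 + 1/N is the constant of Cauchy-Schwarz over that many terms. An
-- extra variable y brings three consecutive sizes of independent sets into one form. Evaluation at
-- y = 0 keeps Euler's formula free of y-derivatives, so that only contractions occur. M / C itself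
-- is never formed. It is replaced by the contraction by C - e, in which e is a loop; this loop is
-- why m is n - |C| and not n - |C| + 1.

module Sum = SemiringSum ℤ.+-*-semiring

-- Integer arithmetic and finite sums

infixl 6 _+_ _-_
infixl 7 _*_
infix  8 -_

-- Opaque copies of the operations: the originals unfold on open terms, which
-- defeats the inference of implicit arguments.
opaque
  _+_ _*_ : ℤ → ℤ → ℤ
  _+_ = Int._+_
  _*_ = Int._*_

  -_ : ℤ → ℤ
  -_ = Int.-_

_-_ : ℤ → ℤ → ℤ
a - b = a + - b

opaque
  unfolding _+_

  ring : AlmostCommutativeRing 0ℓ 0ℓ
  ring = fromCommutativeRing
    record { isCommutativeRing = ℤ.+-*-isCommutativeRing }
    λ { Int.+0 → just refl ; _ → nothing }

opaque
  unfolding _+_ ring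

  +-comm : ∀ a b → a + b ≡ b + a
  +-comm = ℤ.+-comm

  +-assoc : ∀ a b c → a + b + c ≡ a + (b + c)
  +-assoc = ℤ.+-assoc

  +-identityˡ : ∀ a → 0ℤ + a ≡ a
  +-identityˡ = ℤ.+-identityˡ

  +-identityʳ : ∀ a → a + 0ℤ ≡ a
  +-identityʳ = ℤ.+-identityʳ

  *-comm : ∀ a b → a * b ≡ b * a
  *-comm = ℤ.*-comm

  *-assoc : ∀ a b c → a * b * c ≡ a * (b * c)
  *-assoc = ℤ.*-assoc

  *-identityˡ : ∀ a → 1ℤ * a ≡ a
  *-identityˡ = ℤ.*-identityˡ

  *-identityʳ : ∀ a → a * 1ℤ ≡ a
  *-identityʳ = ℤ.*-identityʳ

  *-zeroˡ : ∀ a → 0ℤ * a ≡ 0ℤ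
  *-zeroˡ = ℤ.*-zeroˡ

  *-zeroʳ : ∀ a → a * 0ℤ ≡ 0ℤ
  *-zeroʳ = ℤ.*-zeroʳ

  *≡0 : ∀ a {b} → a * b ≡ 0ℤ → a ≡ 0ℤ ⊎ b ≡ 0ℤ
  *≡0 a = ℤ.i*j≡0⇒i≡0∨j≡0 a

  0≤- : ∀ {a} → a ≤ 0ℤ → 0ℤ ≤ - a
  0≤- = ℤ.neg-mono-≤

  ≤⇒0≤- : ∀ {a b} → a ≤ b → 0ℤ ≤ b - a
  ≤⇒0≤- = ℤ.i≤j⇒0≤j-i

  -≡0⇒≡ : ∀ a b → a - b ≡ 0ℤ → a ≡ b
  -≡0⇒≡ = ℤ.i-j≡0⇒i≡j

  0≤+ : ∀ {a b} → 0ℤ ≤ a → 0ℤ ≤ b → 0ℤ ≤ a + b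
  0≤+ = ℤ.+-mono-≤

  +-mono-≤ : ∀ {a b c d} → a ≤ b → c ≤ d → a + c ≤ b + d
  +-mono-≤ = ℤ.+-mono-≤

  mono-≤ : ∀ k {a b} → 0ℤ ≤ k → a ≤ b → k * a ≤ k * b
  mono-≤ k 0≤k = ℤ.*-monoˡ-≤-nonNeg k {{nonNegative 0≤k}}

  cancel-≤ : ∀ k {a b} → 0ℤ < k → k * a ≤ k * b → a ≤ b
  cancel-≤ k {a} {b} 0<k = ℤ.*-cancelˡ-≤-pos a b k {{positive 0<k}}

  0<* : ∀ {a b} → 0ℤ < a → 0ℤ < b → 0ℤ < a * b
  0<* {a} {b} 0<a 0<b =
    subst (_< a * b) (ℤ.*-zeroʳ a) (ℤ.*-monoˡ-<-pos a {{positive 0<a}} 0<b)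

  neg-square : ∀ a → (- a) * (- a) ≡ a * a
  neg-square = solve-∀ ring

≤-by : ∀ {a b} c → 0ℤ ≤ c → b ≡ a + c → a ≤ b
≤-by {a} c 0≤c refl = subst (_≤ a + c) (+-identityʳ a) (+-mono-≤ (ℤ.≤-refl {a}) 0≤c)

0≤* : ∀ {a b} → 0ℤ ≤ a → 0ℤ ≤ b → 0ℤ ≤ a * b
0≤* {a} {b} 0≤a 0≤b = subst (_≤ a * b) (*-zeroʳ a) (mono-≤ a 0≤a 0≤b)

opaque
  unfolding _+_

  ∑ : ∀ {n} → (Fin n → ℤ) → ℤ
  ∑ = Sum.sum

  ∑-[] : (f : Fin 0 → ℤ) → ∑ f ≡ 0ℤ
  ∑-[] f = refl

  ∑-suc : ∀ {n} (f : Fin (suc n) → ℤ) → ∑ f ≡ f zero + ∑ (f ∘ suc)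
  ∑-suc f = refl

  ∑-cong : ∀ {n} {f g : Fin n → ℤ} → (∀ i → f i ≡ g i) → ∑ f ≡ ∑ g
  ∑-cong = Sum.sum-cong-≗

  ∑-zero : ∀ {n} {f : Fin n → ℤ} → (∀ i → f i ≡ 0ℤ) → ∑ f ≡ 0ℤ
  ∑-zero {n} f≡0 = trans (Sum.sum-cong-≗ f≡0) (Sum.sum-replicate-zero n)

  ∑-+ : ∀ {n} (f g : Fin n → ℤ) → ∑ (λ i → f i + g i) ≡ ∑ f + ∑ g
  ∑-+ = Sum.∑-distrib-+

  ∑-swap : ∀ {m n} (f : Fin m → Fin n → ℤ) → ∑ (λ i → ∑ (f i)) ≡ ∑ (λ j → ∑ (λ i → f i j))
  ∑-swap = Sum.∑-comm

  *-∑ : ∀ {n} k (f : Fin n → ℤ) → k * ∑ f ≡ ∑ (λ i → k * f i)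
  *-∑ = Sum.*-distribˡ-sum

  ∑-* : ∀ {n} k (f : Fin n → ℤ) → ∑ f * k ≡ ∑ (λ i → f i * k)
  ∑-* = Sum.*-distribʳ-sum

  ∑-punchIn : ∀ {n} (f : Fin (suc n) → ℤ) i → ∑ f ≡ f i + ∑ (λ j → f (punchIn i j))
  ∑-punchIn f i = Sum.sum-remove f

0≤-square : ∀ a → 0ℤ ≤ a * a
0≤-square a with ℤ.≤-total 0ℤ a
... | inj₁ 0≤a = 0≤* 0≤a 0≤a
... | inj₂ a≤0 = subst (0ℤ ≤_) (neg-square a) (0≤* (0≤- a≤0) (0≤- a≤0))

0<-square : ∀ {a} → a ≢ 0ℤ → 0ℤ < a * a
0<-square {a} a≢0 = ℤ.≤∧≢⇒< (0≤-square a) λ 0≡aa → [ a≢0 , a≢0 ]′ (*≡0 a (sym 0≡aa))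

∑-mono : ∀ {n} {f g : Fin n → ℤ} → (∀ i → f i ≤ g i) → ∑ f ≤ ∑ g
∑-mono {zero}  {f} {g} f≤g = ℤ.≤-reflexive (trans (∑-[] f) (sym (∑-[] g)))
∑-mono {suc n} {f} {g} f≤g = subst₂ _≤_ (sym (∑-suc f)) (sym (∑-suc g))
  (+-mono-≤ (f≤g zero) (∑-mono (f≤g ∘ suc)))

∑-nonneg : ∀ {n} {f : Fin n → ℤ} → (∀ i → 0ℤ ≤ f i) → 0ℤ ≤ ∑ f
∑-nonneg {n} {f} 0≤f = subst (_≤ ∑ f) (∑-zero {f = λ (_ : Fin n) → 0ℤ} λ _ → refl) (∑-mono 0≤f)

term≤∑ : ∀ {n} {f : Fin n → ℤ} → (∀ i → 0ℤ ≤ f i) → ∀ i → f i ≤ ∑ f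
term≤∑ {f = f} 0≤f zero    = ≤-by _ (∑-nonneg (0≤f ∘ suc)) (∑-suc f)
term≤∑ {f = f} 0≤f (suc i) = ℤ.≤-trans (term≤∑ (0≤f ∘ suc) i)
  (≤-by (f zero) (0≤f zero) (trans (∑-suc f) (+-comm (f zero) _)))

∑≡0⇒term≡0 : ∀ {n} {f : Fin n → ℤ} → (∀ i → 0ℤ ≤ f i) → ∑ f ≡ 0ℤ → ∀ i → f i ≡ 0ℤ
∑≡0⇒term≡0 0≤f ∑≡0 i = ℤ.≤-antisym (subst (_ ≤_) ∑≡0 (term≤∑ 0≤f i)) (0≤f i)

∑-pos⇒∃ : ∀ {n} {f : Fin n → ℤ} → 0ℤ < ∑ f → ∃ λ i → 0ℤ < f i
∑-pos⇒∃ {f = f} 0<∑ with any? (λ i → 0ℤ ℤ.<? f i)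
... | yes found = found
... | no  none  = contradiction 0<∑ (ℤ.≤⇒≯ (subst (∑ f ≤_) (∑-zero {f = λ _ → 0ℤ} λ _ → refl)
  (∑-mono λ i → ℤ.≮⇒≥ λ 0<f → none (i , 0<f))))

-- Dot products and linear systems over ℤ

dot : ∀ {n} → (Fin n → ℤ) → (Fin n → ℤ) → ℤ
dot u v = ∑ λ i → u i * v i

dot-cong : ∀ {n} {u u′ v v′ : Fin n → ℤ} → (∀ i → u i ≡ u′ i) → (∀ i → v i ≡ v′ i) → dot u v ≡ dot u′ v′
dot-cong u≡ v≡ = ∑-cong λ i → cong₂ _*_ (u≡ i) (v≡ i)

dot-comm : ∀ {n} (u v : Fin n → ℤ) → dot u v ≡ dot v u
dot-comm u v = ∑-cong λ i → *-comm (u i) (v i)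

∑-comb : ∀ {n} α β (u v : Fin n → ℤ) → ∑ (λ i → α * u i + β * v i) ≡ α * ∑ u + β * ∑ v
∑-comb α β u v = trans (∑-+ (λ i → α * u i) (λ i → β * v i))
  (sym (cong₂ _+_ (*-∑ α u) (*-∑ β v)))

dot-combʳ : ∀ {n} α β (u v w : Fin n → ℤ) →
            dot w (λ i → α * u i + β * v i) ≡ α * dot w u + β * dot w v
dot-combʳ α β u v w = trans (∑-cong λ i → eq α β (u i) (v i) (w i)) (∑-comb α β _ _)
  where
  opaque
    unfolding _+_ ring
    eq : ∀ α β u v w → w * (α * u + β * v) ≡ α * (w * u) + β * (w * v)
    eq = solve-∀ ring

dot-combˡ : ∀ {n} α β (u v w : Fin n → ℤ) →
            dot (λ i → α * u i + β * v i) w ≡ α * dot u w + β * dot v w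
dot-combˡ α β u v w = trans (dot-comm _ w)
  (trans (dot-combʳ α β u v w) (cong₂ (λ a b → α * a + β * b) (dot-comm w u) (dot-comm w v)))

dot-assoc : ∀ {m n} (u : Fin m → ℤ) (A : Fin m → Fin n → ℤ) (v : Fin n → ℤ) →
            dot u (λ i → dot (A i) v) ≡ dot (λ j → dot u (λ i → A i j)) v
dot-assoc u A v = begin
  ∑ (λ i → u i * ∑ (λ j → A i j * v j))
    ≡⟨ ∑-cong (λ i → *-∑ (u i) _) ⟩
  ∑ (λ i → ∑ (λ j → u i * (A i j * v j)))
    ≡⟨ ∑-swap (λ i j → u i * (A i j * v j)) ⟩
  ∑ (λ j → ∑ (λ i → u i * (A i j * v j)))
    ≡⟨ ∑-cong (λ j → trans (∑-cong λ i → sym (*-assoc (u i) (A i j) (v j)))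
                               (sym (∑-* (v j) (λ i → u i * A i j)))) ⟩
  ∑ (λ j → ∑ (λ i → u i * A i j) * v j) ∎
  where open ≡-Reasoning

dot-zeroˡ : ∀ {n} (u v : Fin n → ℤ) → (∀ i → u i ≡ 0ℤ) → dot u v ≡ 0ℤ
dot-zeroˡ u v u≡0 = ∑-zero λ i → trans (cong (_* v i) (u≡0 i)) (*-zeroˡ (v i))

≢0-* : ∀ {a b} → a ≢ 0ℤ → b ≢ 0ℤ → a * b ≢ 0ℤ
≢0-* {a} a≢0 b≢0 ab≡0 with *≡0 a ab≡0
... | inj₁ a≡0 = a≢0 a≡0
... | inj₂ b≡0 = b≢0 b≡0

-- Solvability is only up to the factor s, since there is no division in ℤ.
fredholm : ∀ {m} n (A : Fin n → Fin m → ℤ) (r : Fin m → ℤ) →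
  (∃[ s ] ∃[ w ] (s ≢ 0ℤ × (∀ i → dot w (λ j → A j i) ≡ s * r i))) ⊎
  (∃[ z ] ((∀ j → dot z (A j) ≡ 0ℤ) × dot z r ≢ 0ℤ))
fredholm zero A r with dot r r ℤ.≟ 0ℤ
... | no  rr≢0 = inj₂ (r , (λ ()) , rr≢0)
... | yes rr≡0 = inj₁ (1ℤ , (λ ()) , (λ ()) , λ i → trans (∑-zero λ ()) (sym (trans (*-identityˡ (r i)) (r≡0 i))))
  where
  r≡0 : ∀ i → r i ≡ 0ℤ
  r≡0 i with r i ℤ.≟ 0ℤ
  ... | yes p = p
  ... | no ri≢0 = contradiction (∑≡0⇒term≡0 (λ j → 0≤-square (r j)) rr≡0 i) (≢0-* ri≢0 ri≢0)
fredholm (suc n) A r with fredholm n (A ∘ suc) r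
... | inj₁ (s , w , s≢0 , Aw≡sr) =
  inj₁ (s , (λ { zero → 0ℤ ; (suc j) → w j }) , s≢0 ,
        λ i → trans (∑-suc _) (trans (cong₂ _+_ (*-zeroˡ (A zero i)) (Aw≡sr i)) (+-identityˡ _)))
... | inj₂ (z , zA≡0 , zr≢0) with dot z (A zero) ℤ.≟ 0ℤ
...   | yes zc≡0 = inj₂ (z , (λ { zero → zc≡0 ; (suc j) → zA≡0 j }) , zr≢0)
-- The new right-hand side is the combination of `r` and the first column that is orthogonal to `z`.
-- A solution for it yields one for `r`. An obstruction `z′` to it becomes an obstruction to `r`
-- once it is corrected by a multiple of `z` to annihilate the first column.
...   | no  zc≢0 with fredholm n (A ∘ suc) (λ i → dot z (A zero) * r i + - dot z r * A zero i)
...     | inj₁ (s , w , s≢0 , Aw≡sr′) =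
  inj₁ (s * dot z (A zero) , (λ { zero → s * dot z r ; (suc j) → w j }) , ≢0-* s≢0 zc≢0 ,
        λ i → trans (∑-suc _) (trans (cong (s * dot z r * A zero i +_) (Aw≡sr′ i))
                    (eq s (dot z (A zero)) (dot z r) (A zero i) (r i))))
  where
  opaque
    unfolding _+_ ring
    eq : ∀ s zc zr c r → s * zr * c + s * (zc * r + - zr * c) ≡ s * zc * r
    eq = solve-∀ ring
...     | inj₂ (z′ , z′A≡0 , z′r′≢0) =
  inj₂ ((λ i → zc * z′ i + - z′c * z i) ,
        (λ { zero → trans (dot-combˡ zc (- z′c) z′ z c) (eq₀ zc z′c)
           ; (suc j) → trans (dot-combˡ zc (- z′c) z′ z (A (suc j)))
                         (trans (cong₂ (λ a b → zc * a + - z′c * b) (z′A≡0 j) (zA≡0 j)) (eq₁ zc z′c)) }) ,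
        λ ≡0 → z′r′≢0 (trans (dot-combʳ zc (- dot z r) r c z′)
                        (trans (eq₂ zc z′c (dot z′ r) (dot z r))
                          (trans (sym (dot-combˡ zc (- z′c) z′ z r)) ≡0))))
  where
  c = A zero
  zc = dot z c
  z′c = dot z′ c
  opaque
    unfolding _+_ ring
    eq₀ : ∀ a b → a * b + - b * a ≡ 0ℤ
    eq₀ = solve-∀ ring
  opaque
    unfolding _+_ ring
    eq₁ : ∀ a b → a * 0ℤ + - b * 0ℤ ≡ 0ℤ
    eq₁ = solve-∀ ring
  opaque
    unfolding _+_ ring
    eq₂ : ∀ zc z′c z′r zr → zc * z′r + - zr * z′c ≡ zc * z′r + - z′c * zr
    eq₂ = solve-∀ ring

-- Quadratic forms over ℤ

⟦_⟧ : ∀ {P : Set} → Dec P → ℤ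
⟦ P? ⟧ = if does P? then 1ℤ else 0ℤ

⟦⟧-true : ∀ {P : Set} (P? : Dec P) → P → ⟦ P? ⟧ ≡ 1ℤ
⟦⟧-true (yes _) _ = refl
⟦⟧-true (no ¬p) p = contradiction p ¬p

⟦⟧-false : ∀ {P : Set} (P? : Dec P) → ¬ P → ⟦ P? ⟧ ≡ 0ℤ
⟦⟧-false (yes p) ¬p = contradiction p ¬p
⟦⟧-false (no _)  _  = refl

⟦⟧-cong : ∀ {P Q : Set} (P? : Dec P) (Q? : Dec Q) → (P → Q) → (Q → P) → ⟦ P? ⟧ ≡ ⟦ Q? ⟧
⟦⟧-cong (yes p) Q? P→Q _   = sym (⟦⟧-true Q? (P→Q p))
⟦⟧-cong (no ¬p) Q? _   Q→P = sym (⟦⟧-false Q? (¬p ∘ Q→P))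

∑-δ : ∀ {n} (i : Fin n) (f : Fin n → ℤ) → ∑ (λ j → ⟦ i ≟ j ⟧ * f j) ≡ f i
∑-δ {suc n} i f = begin
  ∑ (λ j → ⟦ i ≟ j ⟧ * f j)
    ≡⟨ ∑-punchIn _ i ⟩
  ⟦ i ≟ i ⟧ * f i + ∑ (λ j → ⟦ i ≟ punchIn i j ⟧ * f (punchIn i j))
    ≡⟨ cong₂ _+_ (cong (_* f i) (⟦⟧-true (i ≟ i) refl))
                 (∑-zero λ j → trans (cong (_* f (punchIn i j))
                                       (⟦⟧-false (i ≟ punchIn i j) (punchInᵢ≢i i j ∘ sym)))
                                     (*-zeroˡ _)) ⟩
  1ℤ * f i + 0ℤ ≡⟨ trans (+-identityʳ _) (*-identityˡ _) ⟩
  f i ∎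
  where open ≡-Reasoning

∑-δ′ : ∀ {n} (i : Fin n) (f : Fin n → ℤ) → ∑ (λ j → ⟦ j ≟ i ⟧ * f j) ≡ f i
∑-δ′ i f = trans (∑-cong λ j → cong (_* f j) (⟦⟧-cong (j ≟ i) (i ≟ j) sym sym)) (∑-δ i f)

form : ∀ {n} → (Fin n → Fin n → ℤ) → (Fin n → ℤ) → (Fin n → ℤ) → ℤ
form q u v = dot u λ α → dot (q α) v

Symmetric : ∀ {n} → (Fin n → Fin n → ℤ) → Set
Symmetric q = ∀ α β → q α β ≡ q β α

module _ {n} {q : Fin n → Fin n → ℤ} (q-sym : Symmetric q) where

  form-comm : ∀ u v → form q u v ≡ form q v u
  form-comm u v = begin
    dot u (λ α → dot (q α) v)           ≡⟨ dot-assoc u q v ⟩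
    dot (λ β → dot u (λ α → q α β)) v   ≡⟨ dot-comm _ v ⟩
    dot v (λ β → dot u (λ α → q α β))   ≡⟨ dot-cong (λ _ → refl) (λ β →
      trans (dot-comm u _) (dot-cong (λ α → q-sym α β) λ _ → refl)) ⟩
    dot v (λ β → dot (q β) u)           ∎
    where open ≡-Reasoning

  form-combˡ : ∀ α β u v w →
    form q (λ i → α * u i + β * v i) w ≡ α * form q u w + β * form q v w
  form-combˡ α β u v w = dot-combˡ α β u v _

  form-comb : ∀ α β u v →
    form q (λ i → α * u i + β * v i) (λ i → α * u i + β * v i) ≡
    α * (α * form q u u + β * form q u v) + β * (α * form q u v + β * form q v v)
  form-comb α β u v = begin
    form q w w ≡⟨ form-combˡ α β u v w ⟩
    α * form q u w + β * form q v w
      ≡⟨ cong₂ (λ a b → α * a + β * b) (side u) (side v) ⟩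
    α * (α * form q u u + β * form q v u) + β * (α * form q u v + β * form q v v)
      ≡⟨ cong (λ a → α * (α * form q u u + β * a) + β * (α * form q u v + β * form q v v)) (form-comm v u) ⟩
    α * (α * form q u u + β * form q u v) + β * (α * form q u v + β * form q v v) ∎
    where
    open ≡-Reasoning
    w = λ i → α * u i + β * v i
    side : ∀ y → form q y w ≡ α * form q u y + β * form q v y
    side y = trans (form-comm y w) (form-combˡ α β u v y)

  -- The vector `v′` is X times the component of `v` orthogonal to `x`, and q(v′, v′) = X (q(v, v) X
  -- - q(v, x)²). For X = 0 the inequality is trivial, so nonpositivity is demanded only when X is
  -- positive.
  reverse-cauchy-schwarz : ∀ x → 0ℤ ≤ form q x x →
    (0ℤ < form q x x → ∀ v → form q v x ≡ 0ℤ → form q v v ≤ 0ℤ) →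
    ∀ v → form q v v * form q x x ≤ form q v x * form q v x
  reverse-cauchy-schwarz x 0≤X nonpos v with 0ℤ ℤ.≟ form q x x
  ... | yes 0≡X = subst (_≤ form q v x * form q v x)
    (sym (trans (cong (form q v v *_) (sym 0≡X)) (*-zeroʳ _))) (0≤-square (form q v x))
  ... | no  0≢X = cancel-≤ X 0<X (≤-by (- form q v′ v′) (0≤- (nonpos 0<X v′ v′⊥x))
      (trans (eq₂ X (form q v v) Y)
             (cong (λ a → X * (form q v v * X) + - a) (sym (form-comb X (- Y) v x)))))
    where
    X = form q x x
    Y = form q v x
    0<X = ℤ.≤∧≢⇒< 0≤X 0≢X
    v′ = λ i → X * v i + - Y * x i
    opaque
      unfolding _+_ ring
      eq₁ : ∀ X Y → X * Y + - Y * X ≡ 0ℤ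
      eq₁ = solve-∀ ring
    opaque
      unfolding _+_ ring
      eq₂ : ∀ X V Y → X * (Y * Y) ≡
            X * (V * X) + - (X * (X * V + - Y * Y) + - Y * (X * Y + - Y * X))
      eq₂ = solve-∀ ring
    v′⊥x : form q v′ x ≡ 0ℤ
    v′⊥x = trans (form-combˡ X (- Y) v x x) (eq₁ X Y)

  -- The bound makes the form nonpositive on the kernel of `ℓ`, so there is at most one positive
  -- direction. The combination `v′` of `v` and `x` lies in that kernel, and q(v′, v′) = ℓ(x)² q(v,
  -- v) + ℓ(v)² q(x, x) because `v` is orthogonal to `x`.
  nonpositive-on-⊥ : ∀ (ℓ : Fin n → ℤ) K M → 0ℤ < K →
    (∀ v → K * form q v v ≤ M * (dot ℓ v * dot ℓ v)) →
    ∀ x → 0ℤ < form q x x → ∀ v → form q v x ≡ 0ℤ → form q v v ≤ 0ℤ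
  nonpositive-on-⊥ ℓ K M 0<K bound x 0<X v v⊥x =
    cancel-≤ (Lx * Lx) (0<-square Lx≢0)
      (ℤ.≤-trans (≤-by (Lv * Lv * form q x x) (0≤* (0≤-square Lv) (ℤ.<⇒≤ 0<X)) expand)
        (subst (form q v′ v′ ≤_) (sym (*-zeroʳ (Lx * Lx))) v′≤0))
    where
    Lx = dot ℓ x
    Lv = dot ℓ v
    opaque
      unfolding _+_ ring
      eq₀ : ∀ M K → M * (0ℤ * 0ℤ) ≡ K * 0ℤ
      eq₀ = solve-∀ ring
    Lx≢0 : Lx ≢ 0ℤ
    Lx≢0 Lx≡0 = ℤ.<⇒≱ 0<X (cancel-≤ K 0<K (subst (K * form q x x ≤_)
      (trans (cong (λ a → M * (a * a)) Lx≡0) (eq₀ M K)) (bound x)))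
    v′ = λ i → Lx * v i + - Lv * x i
    opaque
      unfolding _+_ ring
      eq₁ : ∀ a b → a * b + - b * a ≡ 0ℤ
      eq₁ = solve-∀ ring
    v′≤0 : form q v′ v′ ≤ 0ℤ
    v′≤0 = cancel-≤ K 0<K (subst (K * form q v′ v′ ≤_)
      (trans (cong (λ a → M * (a * a)) (trans (dot-combʳ Lx (- Lv) v x ℓ) (eq₁ Lx Lv)))
             (eq₀ M K)) (bound v′))
    opaque
      unfolding _+_ ring
      eq₂ : ∀ a b V X → a * (a * V + - b * 0ℤ) + - b * (a * 0ℤ + - b * X) ≡ a * a * V + b * b * X
      eq₂ = solve-∀ ring
    expand : form q v′ v′ ≡ Lx * Lx * form q v v + Lv * Lv * form q x x
    expand = trans (form-comb Lx (- Lv) v x)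
      (trans (cong (λ a → Lx * (Lx * form q v v + - Lv * a) + - Lv * (Lx * a + - Lv * form q x x)) v⊥x)
             (eq₂ Lx Lv (form q v v) (form q x x)))

  -- The Dirichlet energy. The sum runs over ordered pairs, so the square splits into two halves
  -- that are exchanged by swapping the indices; each contributes one of the equal terms on the
  -- right.
  laplacian-form : ∀ t →
    ∑ (λ i → ∑ λ j → q i j * ((t i - t j) * (t i - t j))) ≡
    (dot (λ i → ∑ (q i)) (λ i → t i * t i) - form q t t) +
    (dot (λ i → ∑ (q i)) (λ i → t i * t i) - form q t t)
  laplacian-form t = begin
    ∑ (λ i → ∑ λ j → q i j * ((t i - t j) * (t i - t j)))
      ≡⟨ ∑-cong (λ i → trans (∑-cong λ j → trans (eq (q i j) (t i) (t j))
           (cong (λ a → g i j + (a * (t j * t j) + -1ℤ * (t j * (a * t i)))) (q-sym i j)))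
           (∑-+ (g i) (λ j → g j i))) ⟩
    ∑ (λ i → ∑ (g i) + ∑ (λ j → g j i))
      ≡⟨ ∑-+ _ _ ⟩
    ∑ (λ i → ∑ (g i)) + ∑ (λ i → ∑ (λ j → g j i))
      ≡⟨ cong₂ _+_ half (trans (∑-swap (λ i j → g j i)) half) ⟩
    _ ∎
    where
    open ≡-Reasoning
    g : Fin n → Fin n → ℤ
    g i j = q i j * (t i * t i) + -1ℤ * (t i * (q i j * t j))
    opaque
      unfolding _+_ ring
      eq : ∀ c a b → c * ((a - b) * (a - b)) ≡
           (c * (a * a) + -1ℤ * (a * (c * b))) + (c * (b * b) + -1ℤ * (b * (c * a)))
      eq = solve-∀ ring
    opaque
      unfolding _+_ ring
      eq′ : ∀ a b → 1ℤ * a + -1ℤ * b ≡ a - b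
      eq′ = solve-∀ ring
    half : ∑ (λ i → ∑ (g i)) ≡ dot (λ i → ∑ (q i)) (λ i → t i * t i) - form q t t
    half = trans (∑-cong λ i → trans (∑-+ _ _) (cong₂ _+_
             (trans (sym (∑-* (t i * t i) (q i))) (sym (*-identityˡ _)))
             (trans (sym (*-∑ -1ℤ _)) (cong (-1ℤ *_) (sym (*-∑ (t i) _))))))
           (trans (∑-comb 1ℤ -1ℤ (λ i → ∑ (q i) * (t i * t i)) (λ i → t i * dot (q i) t)) (eq′ _ _))

-- Forms with a distinguished coordinate, and Laplacians

_⊕_ : ∀ {n} → ℤ → (Fin n → ℤ) → Fin (suc n) → ℤ
(a ⊕ u) zero    = a
(a ⊕ u) (suc i) = u i

dot-suc : ∀ {n} (u v : Fin (suc n) → ℤ) → dot u v ≡ u zero * v zero + dot (u ∘ suc) (v ∘ suc)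
dot-suc u v = ∑-suc λ i → u i * v i

𝟙 : ∀ {n} → Fin n → ℤ
𝟙 _ = 1ℤ

dot-𝟙 : ∀ {n} (u : Fin n → ℤ) → dot u 𝟙 ≡ ∑ u
dot-𝟙 u = ∑-cong λ i → *-identityʳ (u i)

𝟙⁺ : ∀ {n} → Fin (suc n) → ℤ
𝟙⁺ = 0ℤ ⊕ 𝟙

dot-𝟙⁺ : ∀ {n} (u : Fin (suc n) → ℤ) → dot u 𝟙⁺ ≡ ∑ (u ∘ suc)
dot-𝟙⁺ u = trans (dot-suc u 𝟙⁺) (trans (cong₂ _+_ (*-zeroʳ (u zero)) (dot-𝟙 (u ∘ suc))) (+-identityˡ _))

∑≢0⇒∃ : ∀ {n} {f : Fin n → ℤ} → ∑ f ≢ 0ℤ → ∃ λ i → f i ≢ 0ℤ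
∑≢0⇒∃ {f = f} ∑≢0 with any? (λ i → ¬? (f i ℤ.≟ 0ℤ))
... | yes found = found
... | no  none  = contradiction
  (∑-zero λ i → decidable-stable (f i ℤ.≟ 0ℤ) λ fi≢0 → none (i , fi≢0)) ∑≢0

-- The matrix `c` is a weighted graph with its row sums as degrees. By `c-connected`, each vertex of
-- nonzero degree is adjacent to one of the two ends of any given edge; this is the shape in which
-- matroid exchange delivers connectivity.
module Laplacian
  {n} {c : Fin n → Fin n → ℤ} (c-sym : Symmetric c) (0≤c : ∀ i j → 0ℤ ≤ c i j)
  (c-connected : ∀ {i j l} → c i l ≢ 0ℤ → ∑ (c j) ≢ 0ℤ → c i j ≢ 0ℤ ⊎ c l j ≢ 0ℤ)
  where

  D : Fin n → ℤ
  D i = ∑ (c i)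

  square-differences-nonneg : ∀ (t : Fin n → ℤ) i j → 0ℤ ≤ c i j * ((t i - t j) * (t i - t j))
  square-differences-nonneg t i j = 0≤* (0≤c i j) (0≤-square (t i - t j))

  form≤diagonal : ∀ t → form c t t ≤ dot D (λ i → t i * t i)
  form≤diagonal t = cancel-≤ (Int.+ 2) (Int.+<+ (Data.Nat.Base.s≤s Data.Nat.Base.z≤n))
    (≤-by _ (∑-nonneg λ i → ∑-nonneg (square-differences-nonneg t i))
      (trans (eq (dot D (λ i → t i * t i)) (form c t t))
             (cong (Int.+ 2 * form c t t +_) (sym (laplacian-form c-sym t)))))
    where
    import Data.Nat.Base
    opaque
      unfolding _+_ ring
      eq : ∀ a b → Int.+ 2 * a ≡ Int.+ 2 * b + ((a - b) + (a - b))
      eq = solve-∀ ring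

  -- A harmonic `z` has energy zero, and the energy is a sum of nonnegative terms, one for each
  -- pair.
  harmonic⇒locally-constant : ∀ z → (∀ j → D j * z j ≡ dot z (λ i → c i j)) →
    ∀ {i j} → c i j ≢ 0ℤ → z i ≡ z j
  harmonic⇒locally-constant z harmonic {i} {j} cij≢0
    with *≡0 (c i j) (∑≡0⇒term≡0 (square-differences-nonneg z i)
           (∑≡0⇒term≡0 (λ i → ∑-nonneg (square-differences-nonneg z i)) energy≡0 i) j)
    where
    opaque
      unfolding _+_ ring
      eq₁ : ∀ a → (a - a) + (a - a) ≡ 0ℤ
      eq₁ = solve-∀ ring
      eq₂ : ∀ d z → d * (z * z) ≡ z * (d * z)
      eq₂ = solve-∀ ring
    diagonal≡form : dot D (λ i → z i * z i) ≡ form c z z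
    diagonal≡form = ∑-cong λ j → trans (eq₂ (D j) (z j)) (cong (z j *_) (trans (harmonic j)
      (trans (dot-comm z _) (dot-cong (λ i → c-sym i j) λ _ → refl))))
    energy≡0 : ∑ (λ i → ∑ λ j → c i j * ((z i - z j) * (z i - z j))) ≡ 0ℤ
    energy≡0 = trans (laplacian-form c-sym z)
      (trans (cong (λ a → (a - form c z z) + (a - form c z z)) diagonal≡form) (eq₁ (form c z z)))
  ... | inj₁ cij≡0 = contradiction cij≡0 cij≢0
  ... | inj₂ sq≡0 with *≡0 (z i - z j) sq≡0
  ...   | inj₁ d≡0 = -≡0⇒≡ (z i) (z j) d≡0
  ...   | inj₂ d≡0 = -≡0⇒≡ (z i) (z j) d≡0

  -- An obstruction `z` in the Fredholm alternative is harmonic, as the Laplacian is symmetric,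
  -- hence constant on the vertices of nonzero degree. Since `r` is supported there, `dot z r` is a
  -- multiple of `∑ r`, which vanishes.
  solvable : ∀ r → (∀ i → D i ≡ 0ℤ → r i ≡ 0ℤ) → ∑ r ≡ 0ℤ →
    ∃[ s ] ∃[ w ] (s ≢ 0ℤ × (∀ i → D i * w i - dot (c i) w ≡ s * r i))
  solvable r r-supported ∑r≡0 with fredholm n (λ j i → ⟦ i ≟ j ⟧ * D i - c i j) r
  ... | inj₁ (s , w , s≢0 , Aw≡sr) = s , w , s≢0 , λ i → trans (sym (apply w i)) (Aw≡sr i)
    where
    opaque
      unfolding _+_ ring
      eq : ∀ w δ d c → w * (δ * d - c) ≡ d * (δ * w) + -1ℤ * (c * w)
      eq = solve-∀ ring
      eq′ : ∀ a b → a + -1ℤ * b ≡ a - b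
      eq′ = solve-∀ ring
    apply : ∀ w i → dot w (λ j → ⟦ i ≟ j ⟧ * D i - c i j) ≡ D i * w i - dot (c i) w
    apply w i = trans (∑-cong λ j → eq (w j) ⟦ i ≟ j ⟧ (D i) (c i j))
      (trans (∑-comb (D i) -1ℤ (λ j → ⟦ i ≟ j ⟧ * w j) (λ j → c i j * w j))
        (trans (cong (λ a → D i * a + -1ℤ * dot (c i) w) (∑-δ i w)) (eq′ _ _)))
  ... | inj₂ (z , zA≡0 , zr≢0) = contradiction zr≡0 zr≢0
    where
    opaque
      unfolding _+_ ring
      eq : ∀ z δ d c → z * (δ * d - c) ≡ 1ℤ * (δ * (d * z)) + -1ℤ * (z * c)
      eq = solve-∀ ring
      eq″ : ∀ a b → a - b ≡ 1ℤ * a + -1ℤ * b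
      eq″ = solve-∀ ring
      eq′ : ∀ a b → 1ℤ * a + -1ℤ * b ≡ 0ℤ → a ≡ b
      eq′ a b p = -≡0⇒≡ a b (trans (eq″ a b) p)
    harmonic : ∀ j → D j * z j ≡ dot z (λ i → c i j)
    harmonic j = eq′ _ _ (trans
      (sym (trans (∑-cong λ i → eq (z i) ⟦ i ≟ j ⟧ (D i) (c i j))
             (trans (∑-comb 1ℤ -1ℤ (λ i → ⟦ i ≟ j ⟧ * (D i * z i)) (λ i → z i * c i j))
               (cong (λ a → 1ℤ * a + -1ℤ * dot z (λ i → c i j)) (∑-δ′ j (λ i → D i * z i))))))
      (zA≡0 j))
    locally-constant : ∀ {i j} → c i j ≢ 0ℤ → z i ≡ z j
    locally-constant = harmonic⇒locally-constant z harmonic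
    constant : ∀ {i j} → D i ≢ 0ℤ → D j ≢ 0ℤ → z i ≡ z j
    constant Di≢0 Dj≢0 with ∑≢0⇒∃ Di≢0
    ... | l , cil≢0 with c-connected cil≢0 Dj≢0
    ...   | inj₁ cij≢0 = locally-constant cij≢0
    ...   | inj₂ clj≢0 = trans (locally-constant cil≢0) (locally-constant clj≢0)
    zr≡0 : dot z r ≡ 0ℤ
    zr≡0 with any? (λ i → ¬? (D i ℤ.≟ 0ℤ))
    ... | no  none = ∑-zero λ i → trans (cong (z i *_)
            (r-supported i (decidable-stable (D i ℤ.≟ 0ℤ) λ Di≢0 → none (i , Di≢0)))) (*-zeroʳ (z i))
    ... | yes (l , Dl≢0) = trans (∑-cong scale)
            (trans (sym (*-∑ (z l) r)) (trans (cong (z l *_) ∑r≡0) (*-zeroʳ (z l))))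
      where
      scale : ∀ i → z i * r i ≡ z l * r i
      scale i with D i ℤ.≟ 0ℤ
      ... | no  Di≢0 = cong (_* r i) (constant Di≢0 Dl≢0)
      ... | yes Di≡0 = trans (cong (z i *_) (r-supported i Di≡0))
        (trans (*-zeroʳ (z i)) (sym (trans (cong (z l *_) (r-supported i Di≡0)) (*-zeroʳ (z l)))))

-- q-local says q(u, u) ≤ Σ D t² for t = D⁻¹ q u, without dividing by D.
module LocalToGlobal
  {n} {q : Fin (suc n) → Fin (suc n) → ℤ} (q-sym : Symmetric q)
  (0≤q : ∀ i j → 0ℤ ≤ q (suc i) (suc j))
  (q-connected : ∀ {i j l} → q (suc i) (suc l) ≢ 0ℤ → ∑ (q (suc j) ∘ suc) ≢ 0ℤ →
                 q (suc i) (suc j) ≢ 0ℤ ⊎ q (suc l) (suc j) ≢ 0ℤ)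
  (q-supported : ∀ i → ∑ (q (suc i) ∘ suc) ≡ 0ℤ → q (suc i) zero ≡ 0ℤ)
  (q-local : ∀ u (t : Fin n → ℤ) → (∀ i → ∑ (q (suc i) ∘ suc) * t i ≡ dot (q (suc i)) u) →
             form q u u ≤ dot (λ i → ∑ (q (suc i) ∘ suc)) (λ i → t i * t i))
  where

  open Laplacian {c = λ i j → q (suc i) (suc j)} (λ i j → q-sym (suc i) (suc j)) 0≤q q-connected

  nonpositive : ∀ v → form q v 𝟙⁺ ≡ 0ℤ → form q v v ≤ 0ℤ
  nonpositive v v⊥𝟙⁺ = from-solution (solvable r r-supported ∑r≡0)
    where
    b : Fin n → ℤ
    b i = q (suc i) zero
    r : Fin n → ℤ
    r i = D i * v (suc i) + b i * v zero
    opaque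
      unfolding _+_ ring
      zeros : ∀ a b → 0ℤ * a + 0ℤ * b ≡ 0ℤ
      zeros = solve-∀ ring
    r-supported : ∀ i → D i ≡ 0ℤ → r i ≡ 0ℤ
    r-supported i Di≡0 = trans
      (cong₂ (λ a a′ → a * v (suc i) + a′ * v zero) Di≡0 (q-supported i Di≡0)) (zeros _ _)
    -- The entries of q 𝟙⁺ are `∑ b` and the `D i`, so `∑ r` equals `form q v 𝟙⁺`: orthogonality to
    -- `𝟙⁺` is the solvability condition of the Laplacian system.
    ∑r≡0 : ∑ r ≡ 0ℤ
    ∑r≡0 = begin
      ∑ r ≡⟨ ∑-+ (λ i → D i * v (suc i)) (λ i → b i * v zero) ⟩
      dot D (v ∘ suc) + ∑ (λ i → b i * v zero)
        ≡⟨ cong₂ _+_ (dot-comm D (v ∘ suc)) (sym (∑-* (v zero) b)) ⟩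
      dot (v ∘ suc) D + ∑ b * v zero
        ≡⟨ +-comm _ _ ⟩
      ∑ b * v zero + dot (v ∘ suc) D
        ≡⟨ cong₂ _+_ (trans (*-comm _ _) (cong (v zero *_) (trans (∑-cong λ i → q-sym (suc i) zero)
                                              (sym (dot-𝟙⁺ (q zero))))))
                     (dot-cong (λ _ → refl) λ i → sym (dot-𝟙⁺ (q (suc i)))) ⟩
      v zero * dot (q zero) 𝟙⁺ + dot (v ∘ suc) (λ i → dot (q (suc i)) 𝟙⁺)
        ≡⟨ sym (dot-suc v _) ⟩
      form q v 𝟙⁺ ≡⟨ v⊥𝟙⁺ ⟩
      0ℤ ∎
      where open ≡-Reasoning
    from-solution :
      ∃[ s ] ∃[ w ] (s ≢ 0ℤ × (∀ i → D i * w i - dot (λ j → q (suc i) (suc j)) w ≡ s * r i)) →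
      form q v v ≤ 0ℤ
    from-solution (s , w , s≢0 , solution) = cancel-≤ (s * s) (0<-square s≢0)
      (ℤ.≤-trans (ℤ.≤-reflexive scaled) (subst (form q difference difference ≤_) (sym (*-zeroʳ (s * s))) bound))
      where
      -- By construction s v = u - t⁺, and `solution` says that D t = q u in the rows of `suc i`. So
      -- `q-local` applies to `u`, and q(u, t⁺) = Σ D t² is the quantity against which both q(u, u)
      -- and q(t⁺, t⁺) are compared.
      u = (s * v zero) ⊕ w
      t = λ i → w i - s * v (suc i)
      t⁺ = 0ℤ ⊕ t
      opaque
        unfolding _+_ ring
        eq₁ : ∀ d w s v cw → d * (w - s * v) ≡ (d * w - cw) - s * (d * v) + cw
        eq₁ = solve-∀ ring
        eq₂ : ∀ s dv bv cw → s * (dv + bv) - s * dv + cw ≡ s * bv + cw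
        eq₂ = solve-∀ ring
        eq₃ : ∀ s b v → s * (b * v) ≡ b * (s * v)
        eq₃ = solve-∀ ring
        eq₄ : ∀ s v → s * v + 0ℤ * 0ℤ ≡ 1ℤ * (s * v) + -1ℤ * 0ℤ
        eq₄ = solve-∀ ring
        eq₅ : ∀ s v w → s * v + 0ℤ * 0ℤ ≡ 1ℤ * w + -1ℤ * (w - s * v)
        eq₅ = solve-∀ ring
        eq₆ : ∀ s a b c → s * (s * a + 0ℤ * b) + 0ℤ * (s * b + 0ℤ * c) ≡ s * s * a
        eq₆ = solve-∀ ring
        eq₇ : ∀ a b c → 0ℤ ≡ (1ℤ * (1ℤ * a + -1ℤ * b) + -1ℤ * (1ℤ * b + -1ℤ * c)) + ((b - a) + (b - c))
        eq₇ = solve-∀ ring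
        eq₈ : ∀ t d → t * (d * t) ≡ d * (t * t)
        eq₈ = solve-∀ ring
      Dt≡qu : ∀ i → D i * t i ≡ dot (q (suc i)) u
      Dt≡qu i = begin
        D i * t i ≡⟨ eq₁ (D i) (w i) s (v (suc i)) cw ⟩
        (D i * w i - cw) - s * (D i * v (suc i)) + cw
          ≡⟨ cong (λ a → a - s * (D i * v (suc i)) + cw) (solution i) ⟩
        s * r i - s * (D i * v (suc i)) + cw
          ≡⟨ eq₂ s (D i * v (suc i)) (b i * v zero) cw ⟩
        s * (b i * v zero) + cw ≡⟨ cong (_+ cw) (eq₃ s (b i) (v zero)) ⟩
        b i * (s * v zero) + cw ≡⟨ sym (dot-suc (q (suc i)) u) ⟩
        dot (q (suc i)) u ∎
        where
        open ≡-Reasoning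
        cw = dot (λ j → q (suc i) (suc j)) w
      DT = dot D (λ i → t i * t i)
      form-t⁺ : ∀ y → form q t⁺ y ≡ dot t (λ i → dot (q (suc i)) y)
      form-t⁺ y = trans (dot-suc t⁺ _) (trans (cong (_+ dot t (λ i → dot (q (suc i)) y)) (*-zeroˡ (dot (q zero) y))) (+-identityˡ _))
      form-ut : form q u t⁺ ≡ DT
      form-ut = trans (form-comm q-sym u t⁺) (trans (form-t⁺ u) (∑-cong λ i →
        trans (cong (t i *_) (sym (Dt≡qu i))) (eq₈ (t i) (D i))))
      form-tt : form q t⁺ t⁺ ≤ DT
      form-tt = subst (_≤ DT) (sym (trans (form-t⁺ t⁺) (dot-cong (λ _ → refl) λ i →
        trans (dot-suc (q (suc i)) t⁺) (trans (cong (_+ dot (λ j → q (suc i) (suc j)) t) (*-zeroʳ (q (suc i) zero))) (+-identityˡ _)))))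
        (form≤diagonal t)
      difference = λ α → 1ℤ * u α + -1ℤ * t⁺ α
      sv≡u-t : ∀ α → s * v α + 0ℤ * 0ℤ ≡ difference α
      sv≡u-t zero    = eq₄ s (v zero)
      sv≡u-t (suc i) = eq₅ s (v (suc i)) (w i)
      -- The zero vector is adjoined only to write s v as a combination of two vectors, the shape
      -- that `form-comb` expands.
      scaled : s * s * form q v v ≡ form q difference difference
      scaled = trans (sym (eq₆ s (form q v v) (form q v 0s) (form q 0s 0s)))
        (trans (sym (form-comb q-sym s 0ℤ v 0s))
          (dot-cong sv≡u-t λ α → dot-cong (λ _ → refl) sv≡u-t))
        where
        0s : Fin (suc n) → ℤ
        0s _ = 0ℤ
      bound : form q difference difference ≤ 0ℤ
      bound = subst (_≤ 0ℤ) (sym (form-comb q-sym 1ℤ -1ℤ u t⁺))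
        (≤-by _ (0≤+ (≤⇒0≤- (subst (form q u u ≤_) (sym form-ut) (q-local u t Dt≡qu)))
                          (≤⇒0≤- (subst (form q t⁺ t⁺ ≤_) (sym form-ut) form-tt)))
          (eq₇ (form q u u) (form q u t⁺) (form q t⁺ t⁺)))

-- Cauchy-Schwarz and partial equivalence relations

cauchy-schwarz : ∀ {n} (u v : Fin n → ℤ) → dot u v * dot u v ≤ dot u u * dot v v
cauchy-schwarz u v with dot u u ℤ.≟ 0ℤ
... | yes U≡0 = ℤ.≤-reflexive (trans
  (trans (cong (_* dot u v) (dot-zeroˡ u v u≡0)) (*-zeroˡ (dot u v)))
  (sym (trans (cong (_* dot v v) U≡0) (*-zeroˡ (dot v v)))))
  where
  u≡0 : ∀ i → u i ≡ 0ℤ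
  u≡0 i with *≡0 (u i) (∑≡0⇒term≡0 (λ j → 0≤-square (u j)) U≡0 i)
  ... | inj₁ p = p
  ... | inj₂ p = p
... | no  U≢0 = cancel-≤ U (ℤ.≤∧≢⇒< (∑-nonneg λ i → 0≤-square (u i)) (U≢0 ∘ sym))
  (≤-by (dot w w) (∑-nonneg λ i → 0≤-square (w i)) (trans (eq U P (dot v v)) (cong (U * (P * P) +_) (sym expand))))
  where
  U = dot u u
  P = dot u v
  w = λ i → U * v i + - P * u i
  opaque
    unfolding _+_ ring
    eq : ∀ U P V → U * (U * V) ≡ U * (P * P) + (U * (U * V + - P * P) + - P * (U * P + - P * U))
    eq = solve-∀ ring
  expand : dot w w ≡ U * (U * dot v v + - P * P) + - P * (U * P + - P * U)
  expand = trans (dot-combˡ U (- P) v u w) (cong₂ (λ a b → U * a + - P * b)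
    (trans (dot-combʳ U (- P) v u v) (cong (λ a → U * dot v v + - P * a) (dot-comm v u)))
    (dot-combʳ U (- P) v u u))

Least : ∀ {n} → (Fin n → Set) → Fin n → Set
Least P i = P i × ∀ j → P j → i Fin.≤ j

least : ∀ {n} {P : Fin n → Set} → Decidable P → ∃ P → ∃ (Least P)
least {suc n} {P} P? (i , Pi) with P? zero
... | yes P0 = zero , P0 , λ _ _ → z≤n
... | no ¬P0 with i | Pi
...   | zero  | P0 = contradiction P0 ¬P0
...   | suc k | Pk with least (P? ∘ suc) (k , Pk)
...     | m , Pm , m≤ = suc m , Pm , λ { zero P0 → contradiction P0 ¬P0 ; (suc j) Pj → s≤s (m≤ j Pj) }

-- Reflexivity fails in the application, where loops are related to nothing. Classes are indexed by
-- their least elements, so that sums over classes are sums over `Fin n`.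
module PartialEquivalence {n} {R : Fin n → Fin n → Set} (R? : ∀ i j → Dec (R i j))
  (R-sym : ∀ {i j} → R i j → R j i) (R-trans : ∀ {i j k} → R i j → R j k → R i k) where

  choose : ∀ i → Dec (∃ (R i)) → Fin n
  choose i (yes ∃R) = proj₁ (least (R? i) ∃R)
  -- An arbitrary value: the factor `a i` in `p` removes the elements that are related to nothing.
  choose i (no _)   = i

  rep : Fin n → Fin n
  rep i = choose i (any? (R? i))

  rep-least : ∀ {i} → R i i → Least (R i) (rep i)
  rep-least {i} Rii with any? (R? i)
  ... | yes ∃R = proj₂ (least (R? i) ∃R)
  ... | no  ∄R = contradiction (i , Rii) ∄R

  rep-cong : ∀ {i j} → R i j → rep i ≡ rep j
  rep-cong {i} {j} Rij =
    let Ri , i≤ = rep-least (R-trans Rij (R-sym Rij))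
        Rj , j≤ = rep-least (R-trans (R-sym Rij) Rij)
    in ≤-antisym (i≤ (rep j) (R-trans Rij Rj)) (j≤ (rep i) (R-trans (R-sym Rij) Ri))

  r : Fin n → Fin n → ℤ
  r i j = ⟦ R? i j ⟧

  a : Fin n → ℤ
  a i = r i i

  p : Fin n → Fin n → ℤ
  p ρ i = ⟦ rep i ≟ ρ ⟧ * a i

  -- The vector `p ρ` is the indicator of the class represented by `ρ`, or zero if `ρ` represents
  -- none. Thus `r` is a Gram matrix and its form a sum of squares.
  r≡∑pp : ∀ i j → r i j ≡ ∑ λ ρ → p ρ i * p ρ j
  r≡∑pp i j = sym (trans (∑-cong λ ρ → *-assoc ⟦ rep i ≟ ρ ⟧ (a i) (p ρ j))
    (trans (∑-δ (rep i) (λ ρ → a i * p ρ j)) eq))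
    where
    eq : a i * (⟦ rep j ≟ rep i ⟧ * a j) ≡ r i j
    eq with R? i i
    ... | no ¬Rii = trans (*-zeroˡ _) (sym (⟦⟧-false (R? i j) λ Rij → ¬Rii (R-trans Rij (R-sym Rij))))
    ... | yes Rii = trans (*-identityˡ _) eq′
      where
      eq′ : ⟦ rep j ≟ rep i ⟧ * a j ≡ r i j
      eq′ with R? j j
      ... | no ¬Rjj = trans (*-zeroʳ _) (sym (⟦⟧-false (R? i j) λ Rij → ¬Rjj (R-trans (R-sym Rij) Rij)))
      ... | yes Rjj = trans (*-identityʳ _) (⟦⟧-cong (rep j ≟ rep i) (R? i j)
        (λ rj≡ri → R-trans (proj₁ (rep-least Rii))
                     (R-sym (subst (R j) rj≡ri (proj₁ (rep-least Rjj)))))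
        (λ Rij → sym (rep-cong Rij)))

  a*p≡p : ∀ ρ i → a ρ * p ρ i ≡ p ρ i
  a*p≡p ρ i with R? i i
  ... | no _ = trans (cong (a ρ *_) (*-zeroʳ _)) (trans (*-zeroʳ (a ρ)) (sym (*-zeroʳ _)))
  ... | yes Rii with rep i ≟ ρ
  ...   | no _     = trans (cong (a ρ *_) (*-zeroˡ _)) (trans (*-zeroʳ (a ρ)) (sym (*-zeroˡ _)))
  ...   | yes refl = trans (cong (_* (1ℤ * 1ℤ)) (⟦⟧-true (R? ρ ρ)
                       (R-trans (R-sym (proj₁ (rep-least Rii))) (proj₁ (rep-least Rii))))) (*-identityˡ _)

  form-r : ∀ w → form r w w ≡ dot (λ ρ → dot (p ρ) w) (λ ρ → dot (p ρ) w)
  form-r w = begin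
    dot w (λ i → dot (r i) w)
      ≡⟨ dot-cong (λ _ → refl) (λ i → dot-cong (r≡∑pp i) (λ _ → refl)) ⟩
    dot w (λ i → dot (λ j → dot (λ ρ → p ρ i) (λ ρ → p ρ j)) w)
      ≡⟨ dot-cong (λ _ → refl) (λ i → sym (dot-assoc (λ ρ → p ρ i) p w)) ⟩
    dot w (λ i → dot (λ ρ → p ρ i) (λ ρ → dot (p ρ) w))
      ≡⟨ dot-assoc w (λ i ρ → p ρ i) _ ⟩
    dot (λ ρ → dot w (p ρ)) (λ ρ → dot (p ρ) w)
      ≡⟨ dot-cong (λ ρ → dot-comm w (p ρ)) (λ _ → refl) ⟩
    dot (λ ρ → dot (p ρ) w) (λ ρ → dot (p ρ) w) ∎
    where open ≡-Reasoning

  dot-a : ∀ w → dot a w ≡ dot a (λ ρ → dot (p ρ) w)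
  dot-a w = sym (begin
    dot a (λ ρ → dot (p ρ) w) ≡⟨ dot-assoc a p w ⟩
    dot (λ i → dot a (λ ρ → p ρ i)) w
      ≡⟨ dot-cong (λ i → trans (∑-cong λ ρ → a*p≡p ρ i) (∑-δ (rep i) (λ _ → a i))) (λ _ → refl) ⟩
    dot a w ∎)
    where open ≡-Reasoning

  form-r-nonneg : ∀ w → 0ℤ ≤ form r w w
  form-r-nonneg w = subst (0ℤ ≤_) (sym (form-r w)) (∑-nonneg λ ρ → 0≤-square (dot (p ρ) w))

  -- Cauchy-Schwarz for `a` and the vector of class sums `dot (p ρ) w`: a representative is related
  -- to itself, so pairing `a` with the class sums recovers `dot a w`.
  dot-a²≤ : ∀ w → dot a w * dot a w ≤ ∑ a * form r w w
  dot-a²≤ w = subst₂ _≤_ (sym (cong₂ _*_ (dot-a w) (dot-a w)))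
    (cong₂ _*_ (∑-cong a*a) (sym (form-r w))) (cauchy-schwarz a (λ ρ → dot (p ρ) w))
    where
    a*a : ∀ i → a i * a i ≡ a i
    a*a i with R? i i
    ... | yes _ = *-identityˡ _
    ... | no  _ = *-zeroˡ _

-- Independence systems

-- Tuples in place of subsets: one element is added at a time, which is a contraction on the matroid
-- side and a call on the side of the game.
Φ : ∀ {n} → (List (Fin n) → ℤ) → ℕ → List (Fin n) → ℤ
Φ ψ zero    s = ψ s
Φ ψ (suc k) s = ∑ λ i → Φ ψ k (i ∷ s)

Φ-resp-↭ : ∀ {n} {ψ : List (Fin n) → ℤ} → (∀ {s s′} → s ↭ s′ → ψ s ≡ ψ s′) →
           ∀ k {s s′} → s ↭ s′ → Φ ψ k s ≡ Φ ψ k s′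
Φ-resp-↭ ψ-resp zero    s↭s′ = ψ-resp s↭s′
Φ-resp-↭ ψ-resp (suc k) s↭s′ = ∑-cong λ i → Φ-resp-↭ ψ-resp k (prep i s↭s′)

⟦⟧-nonneg : ∀ {P : Set} (P? : Dec P) → 0ℤ ≤ ⟦ P? ⟧
⟦⟧-nonneg (yes _) = Int.+≤+ z≤n
⟦⟧-nonneg (no _)  = ℤ.≤-refl

form-∑ : ∀ {m n} (q : Fin m → Fin n → Fin n → ℤ) u v →
         form (λ α β → ∑ λ i → q i α β) u v ≡ ∑ λ i → form (q i) u v
form-∑ q u v = begin
  ∑ (λ α → u α * ∑ (λ β → ∑ (λ i → q i α β) * v β))
    ≡⟨ ∑-cong (λ α → cong (u α *_) (trans (∑-cong λ β → ∑-* (v β) (λ i → q i α β))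
                                          (∑-swap (λ β i → q i α β * v β)))) ⟩
  ∑ (λ α → u α * ∑ (λ i → dot (q i α) v))
    ≡⟨ ∑-cong (λ α → *-∑ (u α) (λ i → dot (q i α) v)) ⟩
  ∑ (λ α → ∑ (λ i → u α * dot (q i α) v))
    ≡⟨ ∑-swap (λ α i → u α * dot (q i α) v) ⟩
  ∑ (λ i → form (q i) u v) ∎
  where open ≡-Reasoning

-- Lists represent sets, so a contraction is the same system over a longer suffix. The hypothesis
-- `exchange` is augmentation in its smallest case, two elements against one above a common `s`.
module IndependenceSystem {n} {Ind : List (Fin n) → Set} (ind? : Decidable Ind)
  (ind-resp-↭ : ∀ {s s′} → s ↭ s′ → Ind s → Ind s′)
  (ind-tail : ∀ {i s} → Ind (i ∷ s) → Ind s)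
  (ind-distinct : ∀ {i s} → ¬ Ind (i ∷ i ∷ s))
  (exchange : ∀ {i j l s} → Ind (i ∷ l ∷ s) → Ind (j ∷ s) → Ind (j ∷ i ∷ s) ⊎ Ind (j ∷ l ∷ s))
  where

  φ : List (Fin n) → ℤ
  φ s = ⟦ ind? s ⟧

  F : ℕ → List (Fin n) → ℤ
  F = Φ φ

  F-resp-↭ : ∀ k {s s′} → s ↭ s′ → F k s ≡ F k s′
  F-resp-↭ = Φ-resp-↭ λ {s} {s′} p → ⟦⟧-cong (ind? s) (ind? s′) (ind-resp-↭ p) (ind-resp-↭ (↭-sym p))

  F-swap : ∀ k i j s → F k (i ∷ j ∷ s) ≡ F k (j ∷ i ∷ s)
  F-swap k i j s = F-resp-↭ k (swap i j ↭-refl)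

  0≤F : ∀ k s → 0ℤ ≤ F k s
  0≤F zero    s = ⟦⟧-nonneg (ind? s)
  0≤F (suc k) s = ∑-nonneg λ i → 0≤F k (i ∷ s)

  F≢0⇒0<F : ∀ k {s} → F k s ≢ 0ℤ → 0ℤ < F k s
  F≢0⇒0<F k {s} F≢0 = ℤ.≤∧≢⇒< (0≤F k s) (F≢0 ∘ sym)

  0<F⇒≢0 : ∀ k {s} → 0ℤ < F k s → F k s ≢ 0ℤ
  0<F⇒≢0 k 0<F F≡0 = ℤ.<-irrefl (sym F≡0) 0<F

  F-cons≤ : ∀ k i s → F k (i ∷ s) ≤ F (suc k) s
  F-cons≤ k i s = term≤∑ (λ i → 0≤F k (i ∷ s)) i

  dependent⇒F≡0 : ∀ k {s} → ¬ Ind s → F k s ≡ 0ℤ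
  dependent⇒F≡0 zero    {s} ¬Is = ⟦⟧-false (ind? s) ¬Is
  dependent⇒F≡0 (suc k)     ¬Is = ∑-zero λ i → dependent⇒F≡0 k (¬Is ∘ ind-tail)

  0<F⇒Ind : ∀ k {s} → 0ℤ < F k s → Ind s
  0<F⇒Ind k {s} 0<F with ind? s
  ... | yes Is = Is
  ... | no ¬Is = contradiction (dependent⇒F≡0 k ¬Is) (0<F⇒≢0 k 0<F)

  -- Augmentation in general, from its smallest case: of the first two elements `b` and `b′` that
  -- extend `s`, one is independent together with `i`, and the induction continues above that one.
  extendable : ∀ k {i s} → Ind (i ∷ s) → 0ℤ < F (suc k) s → 0ℤ < F k (i ∷ s)
  extendable zero    {i} {s} Iis _ = subst (0ℤ <_) (sym (⟦⟧-true (ind? (i ∷ s)) Iis)) (Int.+<+ (s≤s z≤n))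
  extendable (suc k) {i} {s} Iis 0<F with ∑-pos⇒∃ 0<F
  ... | b , 0<Fb with ∑-pos⇒∃ 0<Fb
  ...   | b′ , 0<Fb′b = through (exchange (0<F⇒Ind k 0<Fb′b) Iis)
    where
    via : ∀ {b} → Ind (i ∷ b ∷ s) → 0ℤ < F (suc k) (b ∷ s) → 0ℤ < F (suc k) (i ∷ s)
    via {b} Iibs 0<F = ℤ.<-≤-trans (extendable k Iibs 0<F)
      (subst (_≤ F (suc k) (i ∷ s)) (F-swap k b i s) (F-cons≤ k b (i ∷ s)))
    through : Ind (i ∷ b′ ∷ s) ⊎ Ind (i ∷ b ∷ s) → 0ℤ < F (suc k) (i ∷ s)
    through (inj₂ Iibs)  = via Iibs 0<Fb
    through (inj₁ Iib′s) = via Iib′s (ℤ.<-≤-trans (subst (0ℤ <_) (F-swap k b′ b s) 0<Fb′b)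
                                                  (F-cons≤ k b (b′ ∷ s)))

  -- Up to a scalar, q k s is the Hessian at (y; x) = (0; 1, …, 1) of
  -- ∂_y^{N-1} Σ_I y^{N+k+1-|I|} x^I, where I ranges over the independent sets of
  -- the contraction by s; index zero is the variable y.
  module _ (N : ℤ) where

    q : ℕ → List (Fin n) → Fin (suc n) → Fin (suc n) → ℤ
    q k s zero    zero    = N * (N + 1ℤ) * F k s
    q k s zero    (suc i) = N * F k (i ∷ s)
    q k s (suc i) zero    = N * F k (i ∷ s)
    q k s (suc i) (suc j) = F k (j ∷ i ∷ s)

    q-sym : ∀ k s → Symmetric (q k s)
    q-sym k s zero    zero    = refl
    q-sym k s zero    (suc j) = refl
    q-sym k s (suc i) zero    = refl
    q-sym k s (suc i) (suc j) = F-swap k j i s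

    -- Euler's formula at y = 0 and x = (1, ..., 1): the y-derivative drops out, and the derivative
    -- in the variable of `i` contracts `i`. The degree factor is absorbed by the count of ordered
    -- tuples.
    q-suc : ∀ k s α β → q (suc k) s α β ≡ ∑ λ i → q k (i ∷ s) α β
    q-suc k s zero    zero    = *-∑ (N * (N + 1ℤ)) (λ i → F k (i ∷ s))
    q-suc k s zero    (suc j) = trans (*-∑ N (λ i → F k (i ∷ j ∷ s)))
      (∑-cong λ i → cong (N *_) (F-swap k i j s))
    q-suc k s (suc j) zero    = q-suc k s zero (suc j)
    q-suc k s (suc i) (suc j) = ∑-cong λ l →
      F-resp-↭ k (_↭_.trans (swap l j ↭-refl) (prep j (swap l i ↭-refl)))

    -- Euler's formula again, now for gradients: applying the Hessian of the contraction by `i` to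
    -- `𝟙⁺` gives the row of `i` in the Hessian before contraction. This links the contracted forms
    -- to the vector q u.
    row-sum : ∀ k i s α → ∑ (q k (i ∷ s) α ∘ suc) ≡ q (suc k) s (suc i) α
    row-sum k i s zero    = sym (*-∑ N (λ j → F k (j ∷ i ∷ s)))
    row-sum k i s (suc l) = refl

    form-𝟙⁺ : ∀ k i s u → form (q k (i ∷ s)) u 𝟙⁺ ≡ dot (q (suc k) s (suc i)) u
    form-𝟙⁺ k i s u = trans (dot-comm u _)
      (dot-cong (λ α → trans (dot-𝟙⁺ (q k (i ∷ s) α)) (row-sum k i s α)) λ _ → refl)

    form-𝟙⁺𝟙⁺ : ∀ k s → form (q k s) 𝟙⁺ 𝟙⁺ ≡ F (suc (suc k)) s
    form-𝟙⁺𝟙⁺ k s = trans (dot-comm 𝟙⁺ _) (trans (dot-𝟙⁺ _) (∑-cong λ i → dot-𝟙⁺ (q k s (suc i))))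

    0≤form-𝟙⁺𝟙⁺ : ∀ k s → 0ℤ ≤ form (q k s) 𝟙⁺ 𝟙⁺
    0≤form-𝟙⁺𝟙⁺ k s = subst (0ℤ ≤_) (sym (form-𝟙⁺𝟙⁺ k s)) (0≤F (suc (suc k)) s)

    q-dependent : ∀ k {s} → ¬ Ind s → ∀ α β → q k s α β ≡ 0ℤ
    q-dependent k {s} ¬Is zero    zero    =
      trans (cong (N * (N + 1ℤ) *_) (dependent⇒F≡0 k ¬Is)) (*-zeroʳ _)
    q-dependent k {s} ¬Is zero    (suc j) =
      trans (cong (N *_) (dependent⇒F≡0 k (¬Is ∘ ind-tail))) (*-zeroʳ N)
    q-dependent k {s} ¬Is (suc i) zero    = q-dependent k ¬Is zero (suc i)
    q-dependent k {s} ¬Is (suc i) (suc j) = dependent⇒F≡0 k (¬Is ∘ ind-tail ∘ ind-tail)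

    form-dependent : ∀ k {s} → ¬ Ind s → ∀ u v → form (q k s) u v ≡ 0ℤ
    form-dependent k ¬Is u v =
      ∑-zero λ α → trans (cong (u α *_) (dot-zeroˡ _ v (q-dependent k ¬Is α))) (*-zeroʳ (u α))

    -- The count of nonloops is constrained only after `k` further contractions, at the base of the
    -- induction, so that N need not change on the way.
    Bounded : ℕ → List (Fin n) → Set
    Bounded zero    s = Ind s → ∑ (λ i → φ (i ∷ s)) ≤ N + 1ℤ
    Bounded (suc k) s = ∀ i → Bounded k (i ∷ s)

    ReverseCauchySchwarz : ℕ → List (Fin n) → Set
    ReverseCauchySchwarz k s = ∀ v →
      form (q k s) v v * form (q k s) 𝟙⁺ 𝟙⁺ ≤ form (q k s) v 𝟙⁺ * form (q k s) v 𝟙⁺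

    -- Being parallel is an equivalence relation on the elements i with i ∷ s
    -- independent, so the form is a square minus a sum of squares over at most
    -- N + 1 classes.
    module Base (0≤N : 0ℤ ≤ N) {s} (Is : Ind s) (bound : ∑ (λ i → φ (i ∷ s)) ≤ N + 1ℤ) where

      Parallel : Fin n → Fin n → Set
      Parallel i j = (Ind (i ∷ s) × Ind (j ∷ s)) × ¬ Ind (j ∷ i ∷ s)

      parallel? : ∀ i j → Dec (Parallel i j)
      parallel? i j = (ind? (i ∷ s) ×-dec ind? (j ∷ s)) ×-dec ¬? (ind? (j ∷ i ∷ s))

      parallel-sym : ∀ {i j} → Parallel i j → Parallel j i
      parallel-sym ((Ii , Ij) , ¬Iji) = (Ij , Ii) , ¬Iji ∘ ind-resp-↭ (swap _ _ ↭-refl)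

      parallel-trans : ∀ {i j l} → Parallel i j → Parallel j l → Parallel i l
      parallel-trans ((Ii , Ij) , ¬Iji) ((_ , Il) , ¬Ilj) = (Ii , Il) , λ Ili →
        [ ¬Ilj ∘ ind-resp-↭ (swap _ _ ↭-refl) , ¬Iji ]′ (exchange Ili Ij)

      open PartialEquivalence parallel? parallel-sym parallel-trans

      a≡φ : ∀ i → a i ≡ φ (i ∷ s)
      a≡φ i = ⟦⟧-cong (parallel? i i) (ind? (i ∷ s)) (proj₁ ∘ proj₁) (λ Ii → (Ii , Ii) , ind-distinct)

      φφ≡r+φ : ∀ i j → φ (j ∷ i ∷ s) ≡ a i * a j + -1ℤ * r i j
      φφ≡r+φ i j = trans eq (cong₂ (λ b b′ → b * b′ + -1ℤ * r i j) (sym (a≡φ i)) (sym (a≡φ j)))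
        where
        opaque
          unfolding _+_ ring
          e₁ : 1ℤ ≡ 1ℤ * 1ℤ + -1ℤ * 0ℤ
          e₁ = refl
          e₂ : 0ℤ ≡ 1ℤ * 1ℤ + -1ℤ * 1ℤ
          e₂ = refl
          e₃ : ∀ b → 0ℤ ≡ 0ℤ * b + -1ℤ * 0ℤ
          e₃ = solve-∀ ring
          e₄ : ∀ b → 0ℤ ≡ b * 0ℤ + -1ℤ * 0ℤ
          e₄ = solve-∀ ring
        eq : φ (j ∷ i ∷ s) ≡ φ (i ∷ s) * φ (j ∷ s) + -1ℤ * r i j
        eq with ind? (j ∷ i ∷ s) | ind? (i ∷ s) | ind? (j ∷ s)
        ... | yes _   | yes _  | yes _  = e₁
        ... | yes Iji | no ¬Ii | _      = contradiction (ind-tail Iji) ¬Ii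
        ... | yes Iji | yes _  | no ¬Ij = contradiction (ind-tail (ind-resp-↭ (swap _ _ ↭-refl) Iji)) ¬Ij
        ... | no _    | yes _  | yes _  = e₂
        ... | no _    | no _   | d      = e₃ ⟦ d ⟧
        ... | no _    | yes _  | no _   = e₄ 1ℤ

      -- Completing the square in y: (N + 1) q(v, v) = N ℓ(v)² - ((N + 1) r(w, w) - (a · w)²), where
      -- w is the x-part of `v`. The bracket is nonnegative by `dot-a²≤`, as there are at most N + 1
      -- nonloops.
      ℓ : Fin (suc n) → ℤ
      ℓ = (N + 1ℤ) ⊕ a

      form-q : ∀ v → form (q 0 s) v v ≡
        v zero * (N * (N + 1ℤ) * v zero + N * dot a (v ∘ suc)) +
        (N * v zero * dot a (v ∘ suc) +
         (dot a (v ∘ suc) * dot a (v ∘ suc) - form r (v ∘ suc) (v ∘ suc)))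
      form-q v = trans (dot-suc v _) (cong₂ _+_ (cong (v zero *_) first) rest)
        where
        y = v zero
        w = v ∘ suc
        S = dot a w
        opaque
          unfolding _+_ ring
          e₁ : ∀ N N′ → N * N′ * 1ℤ ≡ N * N′
          e₁ = solve-∀ ring
          e₂ : ∀ N p w → N * p * w ≡ N * (p * w)
          e₂ = solve-∀ ring
          e₃ : ∀ w N p y → w * (N * p * y) ≡ N * y * (p * w)
          e₃ = solve-∀ ring
          e₄ : ∀ a b r w → (a * b + -1ℤ * r) * w ≡ a * (b * w) + -1ℤ * (r * w)
          e₄ = solve-∀ ring
          e₅ : ∀ N w A a S R → w * (N * a * A + (a * S + -1ℤ * R)) ≡
               N * A * (a * w) + (S * (a * w) + -1ℤ * (w * R))
          e₅ = solve-∀ ring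
          e₆ : ∀ A B R → A + (B + -1ℤ * R) ≡ A + (B - R)
          e₆ = solve-∀ ring
        first : dot (q 0 s zero) v ≡ N * (N + 1ℤ) * y + N * S
        first = trans (dot-suc (q 0 s zero) v) (cong₂ _+_
          (cong (_* y) (trans (cong (N * (N + 1ℤ) *_) (⟦⟧-true (ind? s) Is)) (e₁ N (N + 1ℤ))))
          (trans (∑-cong λ i → trans (cong (λ b → N * b * w i) (sym (a≡φ i))) (e₂ N (a i) (w i)))
                 (sym (*-∑ N (λ i → a i * w i)))))
        row : ∀ i → dot (q 0 s (suc i)) v ≡ N * a i * y + (a i * S + -1ℤ * dot (r i) w)
        row i = trans (dot-suc (q 0 s (suc i)) v) (cong₂ _+_
          (cong (λ b → N * b * y) (sym (a≡φ i)))
          (trans (∑-cong λ j → trans (cong (_* w j) (φφ≡r+φ i j)) (e₄ (a i) (a j) (r i j) (w j)))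
                 (∑-comb (a i) -1ℤ (λ j → a j * w j) (λ j → r i j * w j))))
        rest : dot w (λ i → dot (q 0 s (suc i)) v) ≡ N * y * S + (S * S - form r w w)
        rest = trans (∑-cong λ i → trans (cong (w i *_) (row i)) (e₅ N (w i) y (a i) S (dot (r i) w)))
          (trans (∑-+ _ _) (trans (cong₂ _+_ (sym (*-∑ (N * y) (λ i → a i * w i)))
            (∑-comb S -1ℤ (λ i → a i * w i) (λ i → w i * dot (r i) w))) (e₆ (N * y * S) (S * S) (form r w w))))

      form-bound : ∀ v → (N + 1ℤ) * form (q 0 s) v v ≤ N * (dot ℓ v * dot ℓ v)
      form-bound v = ≤-by _ (≤⇒0≤- S²≤)
        (trans (cong (λ b → N * (b * b)) (dot-suc ℓ v))
          (trans (eq N (v zero) S R) (cong (λ b → (N + 1ℤ) * b + ((N + 1ℤ) * R - S * S)) (sym (form-q v)))))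
        where
        S = dot a (v ∘ suc)
        R = form r (v ∘ suc) (v ∘ suc)
        opaque
          unfolding _+_ ring
          eq : ∀ N y S R → N * (((N + 1ℤ) * y + S) * ((N + 1ℤ) * y + S)) ≡
            (N + 1ℤ) * (y * (N * (N + 1ℤ) * y + N * S) + (N * y * S + (S * S - R))) + ((N + 1ℤ) * R - S * S)
          eq = solve-∀ ring
        S²≤ : S * S ≤ (N + 1ℤ) * R
        S²≤ = ℤ.≤-trans (dot-a²≤ (v ∘ suc))
          (subst₂ _≤_ (*-comm R (∑ a)) (*-comm R (N + 1ℤ))
            (mono-≤ R (form-r-nonneg (v ∘ suc)) (subst (_≤ N + 1ℤ) (∑-cong (sym ∘ a≡φ)) bound)))

      opaque
        unfolding _+_
        0<N+1 : 0ℤ < N + 1ℤ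
        0<N+1 = ℤ.+-mono-≤-< 0≤N (Int.+<+ (s≤s z≤n))

      nonpositive : 0ℤ < form (q 0 s) 𝟙⁺ 𝟙⁺ → ∀ v → form (q 0 s) v 𝟙⁺ ≡ 0ℤ → form (q 0 s) v v ≤ 0ℤ
      nonpositive = nonpositive-on-⊥ (q-sym 0 s) ℓ (N + 1ℤ) N 0<N+1 form-bound 𝟙⁺

    reverse-cauchy-schwarz-q : 0ℤ ≤ N → ∀ k s → Bounded k s → ReverseCauchySchwarz k s
    reverse-cauchy-schwarz-q 0≤N zero s bound =
      reverse-cauchy-schwarz (q-sym 0 s) 𝟙⁺ (0≤form-𝟙⁺𝟙⁺ 0 s) nonpositive
      where
      nonpositive : 0ℤ < form (q 0 s) 𝟙⁺ 𝟙⁺ → ∀ v → form (q 0 s) v 𝟙⁺ ≡ 0ℤ → form (q 0 s) v v ≤ 0ℤ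
      nonpositive 0<X with ind? s
      ... | yes Is = Base.nonpositive 0≤N Is (bound Is) 0<X
      ... | no ¬Is = contradiction 0<X (ℤ.≤⇒≯ (ℤ.≤-reflexive (form-dependent 0 ¬Is 𝟙⁺ 𝟙⁺)))
    reverse-cauchy-schwarz-q 0≤N (suc k) s bound =
      reverse-cauchy-schwarz (q-sym (suc k) s) 𝟙⁺ (0≤form-𝟙⁺𝟙⁺ (suc k) s)
        λ 0<X → Step.nonpositive (subst (0ℤ <_) (form-𝟙⁺𝟙⁺ (suc k) s) 0<X)
      where
      -- Positivity of the form at `𝟙⁺` means that `s` has an independent extension by k + 3
      -- elements. By `extendable` every nonloop then lies in such an extension, so only loops have
      -- row sum zero.
      module Step (0<F : 0ℤ < F (suc (suc (suc k))) s) where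

        -- Exchange makes `j` independent together with one end of the edge between `i` and `l`, and
        -- `extendable` enlarges that pair to full size.
        connected : ∀ {i j l} → F (suc k) (l ∷ i ∷ s) ≢ 0ℤ → F (suc (suc k)) (j ∷ s) ≢ 0ℤ →
                    F (suc k) (j ∷ i ∷ s) ≢ 0ℤ ⊎ F (suc k) (j ∷ l ∷ s) ≢ 0ℤ
        connected {i} {j} {l} Fli≢0 Fj≢0
          with exchange (0<F⇒Ind (suc k) 0<Fli) (0<F⇒Ind (suc (suc k)) (F≢0⇒0<F (suc (suc k)) Fj≢0))
          where 0<Fli = F≢0⇒0<F (suc k) Fli≢0
        ... | inj₁ Ijl = inj₂ (0<F⇒≢0 (suc k) (extendable (suc k) Ijl
                (ℤ.<-≤-trans (F≢0⇒0<F (suc k) (Fli≢0 ∘ trans (F-swap (suc k) l i s))) (F-cons≤ (suc k) i (l ∷ s)))))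
        ... | inj₂ Iji = inj₁ (0<F⇒≢0 (suc k) (extendable (suc k) Iji
                (ℤ.<-≤-trans (F≢0⇒0<F (suc k) Fli≢0) (F-cons≤ (suc k) l (i ∷ s)))))

        isolated⇒dependent : ∀ i → F (suc (suc k)) (i ∷ s) ≡ 0ℤ → ¬ Ind (i ∷ s)
        isolated⇒dependent i F≡0 Ii = 0<F⇒≢0 (suc (suc k)) (extendable (suc (suc k)) Ii 0<F) F≡0

        supported : ∀ i → F (suc (suc k)) (i ∷ s) ≡ 0ℤ → N * F (suc k) (i ∷ s) ≡ 0ℤ
        supported i F≡0 =
          trans (cong (N *_) (dependent⇒F≡0 (suc k) (isolated⇒dependent i F≡0))) (*-zeroʳ N)

        -- With D the row sums and q_i the form of the contraction by `i`, the induction hypothesis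
        -- reads q_i(u, u) D_i ≤ (D_i t_i)², because q_i(u, 𝟙⁺) is the row of `i` in q u. Division
        -- by D_i and summation give the bound; if D_i = 0, then `i` is a loop and q_i vanishes.
        local : ∀ u (t : Fin n → ℤ) →
          (∀ i → F (suc (suc k)) (i ∷ s) * t i ≡ dot (q (suc k) s (suc i)) u) →
          form (q (suc k) s) u u ≤ ∑ (λ i → F (suc (suc k)) (i ∷ s) * (t i * t i))
        local u t Dt≡qu = subst (_≤ _)
          (sym (trans (dot-cong (λ _ → refl) λ α → dot-cong (q-suc k s α) λ _ → refl)
                      (form-∑ (λ i → q k (i ∷ s)) u u)))
          (∑-mono summand)
          where
          summand : ∀ i → form (q k (i ∷ s)) u u ≤ F (suc (suc k)) (i ∷ s) * (t i * t i)
          summand i with 0ℤ ℤ.≟ D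
            where D = F (suc (suc k)) (i ∷ s)
          ... | yes 0≡D = ℤ.≤-reflexive
            (trans (form-dependent k (isolated⇒dependent i (sym 0≡D)) u u)
                   (sym (trans (cong (_* (t i * t i)) (sym 0≡D)) (*-zeroˡ _))))
          ... | no  0≢D = cancel-≤ D (ℤ.≤∧≢⇒< (0≤F (suc (suc k)) (i ∷ s)) 0≢D)
            (subst₂ _≤_ (trans (cong (form (q k (i ∷ s)) u u *_) (form-𝟙⁺𝟙⁺ k (i ∷ s))) (*-comm _ D))
              (trans (cong (λ b → b * b) (trans (form-𝟙⁺ k i s u) (sym (Dt≡qu i)))) (eq D (t i)))
              (reverse-cauchy-schwarz-q 0≤N k (i ∷ s) (bound i) u))
            where
            D = F (suc (suc k)) (i ∷ s)
            opaque
              unfolding _+_ ring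
              eq : ∀ d t → (d * t) * (d * t) ≡ d * (d * (t * t))
              eq = solve-∀ ring

        nonpositive : ∀ v → form (q (suc k) s) v 𝟙⁺ ≡ 0ℤ → form (q (suc k) s) v v ≤ 0ℤ
        nonpositive = LocalToGlobal.nonpositive (q-sym (suc k) s)
          (λ i j → 0≤F (suc k) (j ∷ i ∷ s)) connected supported local

    -- Reverse Cauchy-Schwarz in the direction of y: up to the factors N (N + 1), N and 1, the
    -- values q(y, y), q(y, 𝟙⁺) and q(𝟙⁺, 𝟙⁺) are the three consecutive counts.
    ultra-log-concave : 0ℤ < N → ∀ k s → Bounded k s →
      (N + 1ℤ) * (F k s * F (suc (suc k)) s) ≤ N * (F (suc k) s * F (suc k) s)
    ultra-log-concave 0<N k s bound = cancel-≤ N 0<N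
      (subst₂ _≤_ (trans (cong₂ _*_ form-yy (form-𝟙⁺𝟙⁺ k s)) (e₁ N (F k s) (F (suc (suc k)) s)))
                  (trans (cong₂ _*_ form-yx form-yx) (e₂ N (F (suc k) s)))
        (reverse-cauchy-schwarz-q (ℤ.<⇒≤ 0<N) k s bound y))
      where
      y : Fin (suc n) → ℤ
      y = 1ℤ ⊕ λ _ → 0ℤ
      opaque
        unfolding _+_ ring
        e₁ : ∀ N a b → N * (N + 1ℤ) * a * b ≡ N * ((N + 1ℤ) * (a * b))
        e₁ = solve-∀ ring
        e₂ : ∀ N a → N * a * (N * a) ≡ N * (N * (a * a))
        e₂ = solve-∀ ring
      dot-y : ∀ u → dot y u ≡ u zero
      dot-y u = trans (dot-suc y u) (trans (cong₂ _+_ (*-identityˡ (u zero))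
        (dot-zeroˡ _ (u ∘ suc) λ _ → refl)) (+-identityʳ _))
      form-yy : form (q k s) y y ≡ N * (N + 1ℤ) * F k s
      form-yy = trans (dot-y _) (trans (dot-comm _ y) (dot-y (q k s zero)))
      form-yx : form (q k s) y 𝟙⁺ ≡ N * F (suc k) s
      form-yx = trans (dot-y _) (trans (dot-𝟙⁺ (q k s zero)) (sym (*-∑ N (λ i → F k (i ∷ s)))))

-- Counting orderings

private
  variable
    n : ℕ
    X : Set

Unique-resp-↭ : {s s′ : List X} → s ↭ s′ → Unique s → Unique s′
Unique-resp-↭ {X} p = ↭ₛ.Unique-resp-↭ (setoid X) (↭⇒↭ₛ p)

infix 4 _∈?_
_∈?_ : (i : Fin n) (s : List (Fin n)) → Dec (i ∈ s)
_∈?_ = DecMembership._∈?_ _≟_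

unique? : (s : List (Fin n)) → Dec (Unique s)
unique? = DecUnique.unique? _≟_

Unique-tail : {x : X} {s : List X} → Unique (x ∷ s) → Unique s
Unique-tail (_ ∷ u) = u

opaque
  unfolding _+_

  pos-+ : ∀ a b → Int.+ (a ℕ.+ b) ≡ Int.+ a + Int.+ b
  pos-+ = ℤ.pos-+

  pos-* : ∀ a b → Int.+ (a ℕ.* b) ≡ Int.+ a * Int.+ b
  pos-* = ℤ.pos-*

pos-suc-* : ∀ a b → Int.+ suc a * b ≡ b + Int.+ a * b
pos-suc-* a b = trans (cong (_* b) (pos-+ 1 a)) (eq (Int.+ a) b)
  where
  opaque
    unfolding _+_ ring
    eq : ∀ a b → (1ℤ + a) * b ≡ b + a * b
    eq = solve-∀ ring

Φ-cong : ∀ {ψ χ : List (Fin n) → ℤ} → (∀ s → ψ s ≡ χ s) → ∀ k s → Φ ψ k s ≡ Φ χ k s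
Φ-cong ψ≡χ zero    s = ψ≡χ s
Φ-cong ψ≡χ (suc k) s = ∑-cong λ i → Φ-cong ψ≡χ k (i ∷ s)

Φ-* : ∀ a (ψ : List (Fin n) → ℤ) k s → Φ (λ s → a * ψ s) k s ≡ a * Φ ψ k s
Φ-* a ψ zero    s = refl
Φ-* a ψ (suc k) s = trans (∑-cong λ i → Φ-* a ψ k (i ∷ s)) (sym (*-∑ a _))

Φ-∑ : ∀ {m} (ψ : Fin m → List (Fin n) → ℤ) k s → Φ (λ s → ∑ λ e → ψ e s) k s ≡ ∑ λ e → Φ (ψ e) k s
Φ-∑ ψ zero    s = refl
Φ-∑ ψ (suc k) s = trans (∑-cong λ i → Φ-∑ ψ k (i ∷ s)) (∑-swap λ i e → Φ (ψ e) k (i ∷ s))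

-- The definition of `Φ` peels off the element added first, the earliest call. This form peels off
-- the latest call, the one that completes the circuit.
Φ-suc : ∀ (ψ : List (Fin n) → ℤ) k s → Φ ψ (suc k) s ≡ Φ (λ s → ∑ λ e → ψ (e ∷ s)) k s
Φ-suc ψ zero    s = refl
Φ-suc ψ (suc k) s = ∑-cong λ i → Φ-suc ψ k (i ∷ s)

-- A function of sets, extended by zero to lists with repetitions, so that a sum over all tuples
-- sees only those with distinct entries.
record SetFunction (ψ : List (Fin n) → ℤ) : Set where
  field
    resp-↭     : ∀ {s s′} → s ↭ s′ → ψ s ≡ ψ s′
    repetition : ∀ s → ¬ Unique s → ψ s ≡ 0ℤ

  Φ-repetition : ∀ k s → ¬ Unique s → Φ ψ k s ≡ 0ℤ
  Φ-repetition zero    s ¬u = repetition s ¬u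
  Φ-repetition (suc k) s ¬u = ∑-zero λ i → Φ-repetition k (i ∷ s) (¬u ∘ Unique-tail)

  Φ-↭ : ∀ k {s s′} → s ↭ s′ → Φ ψ k s ≡ Φ ψ k s′
  Φ-↭ = Φ-resp-↭ resp-↭

module _ {ψ : List (Fin n) → ℤ} (ψ-set : SetFunction ψ) (x : Fin n) where

  open SetFunction ψ-set

  ψ-∋ : List (Fin n) → ℤ
  ψ-∋ s = ⟦ x ∈? s ⟧ * ψ s

  ∋-setFunction : SetFunction ψ-∋
  ∋-setFunction = record
    { resp-↭     = λ {s} {s′} p → cong₂ _*_
                     (⟦⟧-cong (x ∈? s) (x ∈? s′) (∈-resp-↭ p) (∈-resp-↭ (↭-sym p))) (resp-↭ p)
    ; repetition = λ s ¬u → trans (cong (⟦ x ∈? s ⟧ *_) (repetition s ¬u)) (*-zeroʳ _)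
    }

  Φ-∋-present : ∀ k s → x ∈ s → Φ ψ-∋ k s ≡ Φ ψ k s
  Φ-∋-present zero    s x∈s = trans (cong (_* ψ s) (⟦⟧-true (x ∈? s) x∈s)) (*-identityˡ _)
  Φ-∋-present (suc k) s x∈s = ∑-cong λ i → Φ-∋-present k (i ∷ s) (there x∈s)

  Φ-∋-zero : ∀ s → x ∉ s → Φ ψ-∋ 0 s ≡ 0ℤ
  Φ-∋-zero s x∉s = trans (cong (_* ψ s) (⟦⟧-false (x ∈? s) x∉s)) (*-zeroˡ _)

  -- x occupies exactly one of the k + 1 added positions.
  Φ-∋-suc : ∀ k s → x ∉ s → Φ ψ-∋ (suc k) s ≡ Int.+ suc k * Φ ψ k (x ∷ s)
  Φ-∋-suc zero s x∉s = trans (∑-cong entry)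
    (trans (∑-δ x (λ i → ψ (i ∷ s))) (sym (*-identityˡ _)))
    where
    entry : ∀ i → ⟦ x ∈? (i ∷ s) ⟧ * ψ (i ∷ s) ≡ ⟦ x ≟ i ⟧ * ψ (i ∷ s)
    entry i = cong (_* ψ (i ∷ s)) (⟦⟧-cong (x ∈? (i ∷ s)) (x ≟ i)
      (λ { (here x≡i) → x≡i ; (there x∈s) → contradiction x∈s x∉s }) here)
  Φ-∋-suc (suc k) s x∉s = begin
    ∑ (λ i → Φ ψ-∋ (suc k) (i ∷ s))
      ≡⟨ ∑-cong entry ⟩
    ∑ (λ i → ⟦ x ≟ i ⟧ * Φ ψ (suc k) (i ∷ s) + Int.+ suc k * Φ ψ k (i ∷ x ∷ s))
      ≡⟨ ∑-+ _ _ ⟩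
    ∑ (λ i → ⟦ x ≟ i ⟧ * Φ ψ (suc k) (i ∷ s)) + ∑ (λ i → Int.+ suc k * Φ ψ k (i ∷ x ∷ s))
      ≡⟨ cong₂ _+_ (∑-δ x (λ i → Φ ψ (suc k) (i ∷ s))) (sym (*-∑ (Int.+ suc k) _)) ⟩
    Φ ψ (suc k) (x ∷ s) + Int.+ suc k * Φ ψ (suc k) (x ∷ s)
      ≡⟨ sym (pos-suc-* (suc k) _) ⟩
    Int.+ suc (suc k) * Φ ψ (suc k) (x ∷ s) ∎
    where
    open ≡-Reasoning
    entry : ∀ i → Φ ψ-∋ (suc k) (i ∷ s) ≡
                  ⟦ x ≟ i ⟧ * Φ ψ (suc k) (i ∷ s) + Int.+ suc k * Φ ψ k (i ∷ x ∷ s)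
    entry i with x ≟ i
    ... | yes refl = begin
      Φ ψ-∋ (suc k) (x ∷ s) ≡⟨ Φ-∋-present (suc k) (x ∷ s) (here refl) ⟩
      Φ ψ (suc k) (x ∷ s)   ≡⟨ sym (+-identityʳ _) ⟩
      Φ ψ (suc k) (x ∷ s) + 0ℤ
        ≡⟨ cong₂ _+_ (sym (*-identityˡ _)) (sym (trans (cong (Int.+ suc k *_)
             (Φ-repetition k (x ∷ x ∷ s) λ u → Unique[x∷xs]⇒x∉xs u (here refl))) (*-zeroʳ _))) ⟩
      1ℤ * Φ ψ (suc k) (x ∷ s) + Int.+ suc k * Φ ψ k (x ∷ x ∷ s) ∎
    ... | no  x≢i = begin
      Φ ψ-∋ (suc k) (i ∷ s)
        ≡⟨ Φ-∋-suc k (i ∷ s) (λ { (here x≡i) → x≢i x≡i ; (there x∈s) → x∉s x∈s }) ⟩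
      Int.+ suc k * Φ ψ k (x ∷ i ∷ s)
        ≡⟨ cong (Int.+ suc k *_) (Φ-↭ k (swap x i ↭-refl)) ⟩
      Int.+ suc k * Φ ψ k (i ∷ x ∷ s)
        ≡⟨ sym (+-identityˡ _) ⟩
      0ℤ + Int.+ suc k * Φ ψ k (i ∷ x ∷ s)
        ≡⟨ cong (_+ Int.+ suc k * Φ ψ k (i ∷ x ∷ s)) (sym (*-zeroˡ _)) ⟩
      0ℤ * Φ ψ (suc k) (i ∷ s) + Int.+ suc k * Φ ψ k (i ∷ x ∷ s) ∎

containing : (List (Fin n) → ℤ) → List (Fin n) → List (Fin n) → ℤ
containing ψ []       s = ψ s
containing ψ (x ∷ xs) s = ⟦ x ∈? s ⟧ * containing ψ xs s

module _ {ψ : List (Fin n) → ℤ} (ψ-set : SetFunction ψ) where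

  containing-setFunction : ∀ xs → SetFunction (containing ψ xs)
  containing-setFunction []       = ψ-set
  containing-setFunction (x ∷ xs) = ∋-setFunction (containing-setFunction xs) x

  Unique-shift : ∀ (x : Fin n) xs {s} → Unique (x ∷ xs ++ s) → Unique (xs ++ x ∷ s)
  Unique-shift x xs {s} = Unique-resp-↭ (↭-sym (shift x xs s))

  ∉-suffix : ∀ {x : Fin n} xs {s} → Unique (x ∷ xs ++ s) → x ∉ s
  ∉-suffix xs u x∈s = Unique[x∷xs]⇒x∉xs u (∈-++⁺ʳ xs x∈s)

  Φ-containing-short : ∀ xs {m s} → Unique (xs ++ s) → m ℕ.< length xs → Φ (containing ψ xs) m s ≡ 0ℤ
  Φ-containing-short (x ∷ xs) {zero}  {s} u _ = Φ-∋-zero (containing-setFunction xs) x s (∉-suffix xs u)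
  Φ-containing-short (x ∷ xs) {suc m} {s} u (s≤s m<) = begin
    Φ (containing ψ (x ∷ xs)) (suc m) s
      ≡⟨ Φ-∋-suc (containing-setFunction xs) x m s (∉-suffix xs u) ⟩
    Int.+ suc m * Φ (containing ψ xs) m (x ∷ s)
      ≡⟨ cong (Int.+ suc m *_) (Φ-containing-short xs (Unique-shift x xs u) m<) ⟩
    Int.+ suc m * 0ℤ ≡⟨ *-zeroʳ _ ⟩
    0ℤ ∎
    where open ≡-Reasoning

  -- The (|xs| + k)! / k! placements of `xs` among the |xs| + k new positions contribute equally;
  -- the factor `k !` on the left avoids the quotient.
  Φ-containing : ∀ xs k {s} → Unique (xs ++ s) →
    Φ (containing ψ xs) (length xs ℕ.+ k) s * Int.+ (k !) ≡ Int.+ ((length xs ℕ.+ k) !) * Φ ψ k (xs ++ s)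
  Φ-containing []       k {s} u = *-comm _ _
  Φ-containing (x ∷ xs) k {s} u = begin
    Φ (containing ψ (x ∷ xs)) (suc m) s * Int.+ (k !)
      ≡⟨ cong (_* Int.+ (k !)) (Φ-∋-suc (containing-setFunction xs) x m s (∉-suffix xs u)) ⟩
    Int.+ suc m * Φ (containing ψ xs) m (x ∷ s) * Int.+ (k !)
      ≡⟨ *-assoc _ _ _ ⟩
    Int.+ suc m * (Φ (containing ψ xs) m (x ∷ s) * Int.+ (k !))
      ≡⟨ cong (Int.+ suc m *_) (Φ-containing xs k (Unique-shift x xs u)) ⟩
    Int.+ suc m * (Int.+ (m !) * Φ ψ k (xs ++ x ∷ s))
      ≡⟨ sym (*-assoc _ _ _) ⟩
    Int.+ suc m * Int.+ (m !) * Φ ψ k (xs ++ x ∷ s)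
      ≡⟨ cong₂ _*_ (sym (pos-* (suc m) (m !))) (SetFunction.Φ-↭ ψ-set k (shift x xs s)) ⟩
    Int.+ (suc m !) * Φ ψ k (x ∷ xs ++ s) ∎
    where
    open ≡-Reasoning
    m = length xs ℕ.+ k

listSum : (X → ℤ) → List X → ℤ
listSum f []       = 0ℤ
listSum f (x ∷ xs) = f x + listSum f xs

listSum-cong : ∀ {f g : X → ℤ} → (∀ x → f x ≡ g x) → ∀ xs → listSum f xs ≡ listSum g xs
listSum-cong f≡g []       = refl
listSum-cong f≡g (x ∷ xs) = cong₂ _+_ (f≡g x) (listSum-cong f≡g xs)

listSum-const : ∀ a (xs : List X) → listSum (λ _ → a) xs ≡ Int.+ length xs * a
listSum-const a []       = sym (*-zeroˡ a)
listSum-const a (x ∷ xs) = trans (cong (a +_) (listSum-const a xs)) (sym (pos-suc-* (length xs) a))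

listSum-++ : ∀ (f : X → ℤ) xs ys → listSum f (xs ++ ys) ≡ listSum f xs + listSum f ys
listSum-++ f []       ys = sym (+-identityˡ _)
listSum-++ f (x ∷ xs) ys = trans (cong (f x +_) (listSum-++ f xs ys)) (sym (+-assoc _ _ _))

listSum-map : ∀ {B : Set} (f : B → ℤ) (g : X → B) xs → listSum f (map g xs) ≡ listSum (f ∘ g) xs
listSum-map f g []       = refl
listSum-map f g (x ∷ xs) = cong (f (g x) +_) (listSum-map f g xs)

listSum-tabulate : ∀ (f : X → ℤ) (g : Fin n → X) → listSum f (List.tabulate g) ≡ ∑ (f ∘ g)
listSum-tabulate {n = zero}  f g = sym (∑-[] (f ∘ g))
listSum-tabulate {n = suc n} f g =
  trans (cong (f (g zero) +_) (listSum-tabulate f (g ∘ suc))) (sym (∑-suc (f ∘ g)))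

listSum-product : ∀ {B C : Set} (f : C → ℤ) (g : X → B → C) xs ys →
  listSum f (cartesianProductWith g xs ys) ≡ listSum (λ x → listSum (f ∘ g x) ys) xs
listSum-product f g []       ys = refl
listSum-product f g (x ∷ xs) ys = trans (listSum-++ f (map (g x) ys) _)
  (cong₂ _+_ (listSum-map f (g x) ys) (listSum-product f g xs ys))

length-filter : ∀ {P : X → Set} (P? : Decidable P) xs →
                Int.+ length (filter P? xs) ≡ listSum (λ x → ⟦ P? x ⟧) xs
length-filter P? [] = refl
length-filter P? (x ∷ xs) with P? x
... | yes _ = trans (pos-+ 1 _) (cong (1ℤ +_) (length-filter P? xs))
... | no  _ = trans (length-filter P? xs) (sym (+-identityˡ _))

-- Latest call first.
calls : Permutation′ n → ℕ → List (Fin n)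
calls σ t = reverse (take t (List.tabulate (σ ⟨$⟩ʳ_)))

calls-insert : ∀ i (π : Permutation′ n) t →
  calls (insert zero i π) (suc t) ≡ map (punchIn i) (calls π t) ++ [ i ]
calls-insert i π t = begin
  reverse (i ∷ take t (List.tabulate (punchIn i ∘ (π ⟨$⟩ʳ_))))
    ≡⟨ unfold-reverse i (take t (List.tabulate (punchIn i ∘ (π ⟨$⟩ʳ_)))) ⟩
  reverse (take t (List.tabulate (punchIn i ∘ (π ⟨$⟩ʳ_)))) ++ [ i ]
    ≡⟨ cong (λ l → reverse (take t l) ++ [ i ]) (sym (map-tabulate (π ⟨$⟩ʳ_) (punchIn i))) ⟩
  reverse (take t (map (punchIn i) (List.tabulate (π ⟨$⟩ʳ_)))) ++ [ i ]
    ≡⟨ cong (λ l → reverse l ++ [ i ]) (take-map t _) ⟩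
  reverse (map (punchIn i) (take t (List.tabulate (π ⟨$⟩ʳ_)))) ++ [ i ]
    ≡⟨ cong (_++ [ i ]) (sym (reverse-map (punchIn i) (take t (List.tabulate (π ⟨$⟩ʳ_))))) ⟩
  map (punchIn i) (calls π t) ++ [ i ] ∎
  where open ≡-Reasoning

onUnique : (List (Fin n) → ℤ) → List (Fin n) → ℤ
onUnique h s = ⟦ unique? s ⟧ * h s

onUnique-repetition : ∀ (h : List (Fin n) → ℤ) k s → ¬ Unique s → Φ (onUnique h) k s ≡ 0ℤ
onUnique-repetition h zero    s ¬u = trans (cong (_* h s) (⟦⟧-false (unique? s) ¬u)) (*-zeroˡ (h s))
onUnique-repetition h (suc k) s ¬u = ∑-zero λ i → onUnique-repetition h k (i ∷ s) (¬u ∘ Unique-tail)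

after : Fin (suc n) → List (Fin n) → List (Fin (suc n))
after i s = map (punchIn i) s ++ [ i ]

Unique-after : ∀ (i : Fin (suc n)) {s} → Unique s → Unique (after i s)
Unique-after i {s} u = Unique-resp-↭ (↭-sym (shift i (map (punchIn i) s) []))
  (subst (λ l → Unique (i ∷ l)) (sym (++-identityʳ _))
    (¬Any⇒All¬ _ (λ i∈ → let j , _ , i≡ = ∈-map⁻ (punchIn i) i∈ in punchInᵢ≢i i j (sym i≡))
      ∷ map⁺ (punchIn-injective i _ _) u))

Unique-after⁻ : ∀ (i : Fin (suc n)) {s} → Unique (after i s) → Unique s
Unique-after⁻ i {s} u = map⁻ (subst Unique (++-identityʳ _)
  (Unique-tail (Unique-resp-↭ (shift i (map (punchIn i) s) []) u)))

-- Calling `i` a second time is a repetition and contributes zero. The other elements form the image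
-- of `punchIn i`, which reduces the sum to the smaller ground set.
Φ-after : ∀ (h : List (Fin (suc n)) → ℤ) i k s →
          Φ (onUnique h) k (after i s) ≡ Φ (onUnique (h ∘ after i)) k s
Φ-after h i zero    s = cong (_* h (after i s))
  (⟦⟧-cong (unique? (after i s)) (unique? s) (Unique-after⁻ i) (Unique-after i))
Φ-after h i (suc k) s = trans (∑-punchIn _ i)
  (trans (cong₂ _+_ (onUnique-repetition h k (i ∷ after i s)
                      λ u → Unique[x∷xs]⇒x∉xs u (∈-++⁺ʳ (map (punchIn i) s) (here refl)))
                    (∑-cong λ j → Φ-after h i k (j ∷ s)))
         (+-identityˡ _))

-- Each list of t distinct calls begins r! orderings. The induction removes the first call, just as
-- `insert zero` supplies it in `permutations`, and the ground set of size t + r shrinks along with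
-- t.
sum-over-permutations : ∀ t r (h : List (Fin (t ℕ.+ r)) → ℤ) →
  listSum (λ σ → h (calls σ t)) (permutations (t ℕ.+ r)) ≡ Int.+ (r !) * Φ (onUnique h) t []
sum-over-permutations zero    r h = trans (listSum-const (h []) (permutations r))
  (cong₂ (λ l a → Int.+ l * a) (length-permutations r) (sym (*-identityˡ (h []))))
sum-over-permutations (suc t) r h = begin
  listSum (λ σ → h (calls σ (suc t))) (cartesianProductWith (insert zero) (allFin (suc (t ℕ.+ r))) (permutations (t ℕ.+ r)))
    ≡⟨ listSum-product _ (insert zero) (allFin (suc (t ℕ.+ r))) (permutations (t ℕ.+ r)) ⟩
  listSum (λ i → listSum (λ π → h (calls (insert zero i π) (suc t))) (permutations (t ℕ.+ r))) (allFin (suc (t ℕ.+ r)))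
    ≡⟨ listSum-tabulate _ (λ i → i) ⟩
  ∑ (λ i → listSum (λ π → h (calls (insert zero i π) (suc t))) (permutations (t ℕ.+ r)))
    ≡⟨ ∑-cong (λ i → trans (listSum-cong (λ π → cong h (calls-insert i π t)) (permutations (t ℕ.+ r)))
         (trans (sum-over-permutations t r (h ∘ after i))
                (cong (Int.+ (r !) *_) (sym (Φ-after h i t []))))) ⟩
  ∑ (λ i → Int.+ (r !) * Φ (onUnique h) t [ i ])
    ≡⟨ sym (*-∑ (Int.+ (r !)) _) ⟩
  Int.+ (r !) * Φ (onUnique h) (suc t) [] ∎
  where open ≡-Reasoning

-- Matroids

x∉p-x : ∀ (p : Subset n) x → x ∉ˢ p -ˢ x
x∉p-x (true  ∷ p) zero    ()
x∉p-x (false ∷ p) zero    ()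
x∉p-x (true  ∷ p) (suc x) (Vec.there x∈) = x∉p-x p x x∈
x∉p-x (false ∷ p) (suc x) (Vec.there x∈) = x∉p-x p x x∈

⟦⟧-× : ∀ {P Q : Set} (P? : Dec P) (Q? : Dec Q) → ⟦ P? ⟧ * ⟦ Q? ⟧ ≡ ⟦ P? ×-dec Q? ⟧
⟦⟧-× (yes _) Q? = *-identityˡ ⟦ Q? ⟧
⟦⟧-× (no _)  Q? = *-zeroˡ ⟦ Q? ⟧

all-contained? : ∀ (xs s : List (Fin n)) → Dec (All (_∈ s) xs)
all-contained? xs s = All.all? (_∈? s) xs

containing-⟦⟧ : ∀ {P : List (Fin n) → Set} (P? : Decidable P) xs s →
  containing (λ s → ⟦ P? s ⟧) xs s ≡ ⟦ all-contained? xs s ×-dec P? s ⟧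
containing-⟦⟧ P? []       s = ⟦⟧-cong (P? s) (all-contained? [] s ×-dec P? s) ([] ,_) proj₂
containing-⟦⟧ P? (x ∷ xs) s = trans (cong (⟦ x ∈? s ⟧ *_) (containing-⟦⟧ P? xs s))
  (trans (⟦⟧-× (x ∈? s) (all-contained? xs s ×-dec P? s))
         (⟦⟧-cong ((x ∈? s) ×-dec (all-contained? xs s ×-dec P? s)) (all-contained? (x ∷ xs) s ×-dec P? s)
           (λ { (x∈ , xs⊆ , p) → x∈ ∷ xs⊆ , p }) (λ { (x∈ ∷ xs⊆ , p) → x∈ , xs⊆ , p })))

∑-∈ : ∀ {s : List (Fin n)} → Unique s → ∑ (λ i → ⟦ i ∈? s ⟧) ≡ Int.+ length s
∑-∈ {s = []}    u = ∑-zero λ i → ⟦⟧-false (i ∈? []) λ ()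
∑-∈ {s = x ∷ s} u = begin
  ∑ (λ i → ⟦ i ∈? (x ∷ s) ⟧)            ≡⟨ ∑-cong entry ⟩
  ∑ (λ i → ⟦ x ≟ i ⟧ * 1ℤ + ⟦ i ∈? s ⟧) ≡⟨ ∑-+ _ _ ⟩
  ∑ (λ i → ⟦ x ≟ i ⟧ * 1ℤ) + ∑ (λ i → ⟦ i ∈? s ⟧)
    ≡⟨ cong₂ _+_ (∑-δ x (λ _ → 1ℤ)) (∑-∈ (Unique-tail u)) ⟩
  1ℤ + Int.+ length s ≡⟨ sym (pos-+ 1 (length s)) ⟩
  Int.+ suc (length s) ∎
  where
  open ≡-Reasoning
  entry : ∀ i → ⟦ i ∈? (x ∷ s) ⟧ ≡ ⟦ x ≟ i ⟧ * 1ℤ + ⟦ i ∈? s ⟧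
  entry i with x ≟ i
  ... | yes refl = trans (⟦⟧-true (x ∈? (x ∷ s)) (here refl)) (sym (trans
          (cong₂ _+_ (*-identityˡ 1ℤ) (⟦⟧-false (x ∈? s) (Unique[x∷xs]⇒x∉xs u))) (+-identityʳ 1ℤ)))
  ... | no  x≢i  = trans (⟦⟧-cong (i ∈? (x ∷ s)) (i ∈? s)
          (λ { (here i≡x) → contradiction (sym i≡x) x≢i ; (there i∈s) → i∈s }) there)
          (sym (trans (cong (_+ ⟦ i ∈? s ⟧) (*-zeroˡ 1ℤ)) (+-identityˡ _)))

∑-1 : ∀ n → ∑ {n} (λ _ → 1ℤ) ≡ Int.+ n
∑-1 zero    = ∑-[] _
∑-1 (suc n) = trans (∑-suc _) (trans (cong (1ℤ +_) (∑-1 n)) (sym (pos-+ 1 n)))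

Φ-++ : ∀ (ψ : List (Fin n) → ℤ) k s b → Φ ψ k (s ++ b) ≡ Φ (λ s → ψ (s ++ b)) k s
Φ-++ ψ zero    s b = refl
Φ-++ ψ (suc k) s b = ∑-cong λ i → Φ-++ ψ k (i ∷ s) b

Unique-∷ : ∀ {x : Fin n} {s} → x ∉ s → Unique s → Unique (x ∷ s)
Unique-∷ x∉s u = ¬Any⇒All¬ _ x∉s ∷ u

same-members⇒↭ : ∀ {xs ys : List (Fin n)} → Unique xs → Unique ys →
  (∀ {x} → x ∈ xs → x ∈ ys) → (∀ {x} → x ∈ ys → x ∈ xs) → xs ↭ ys
same-members⇒↭ u v to from = ∼bag⇒↭ (unique∧set⇒bag u v (mk⇔ to from))

∈-take-tabulate⁺ : ∀ {m} (f : Fin n → Fin m) {j} t → toℕ j ℕ.< t → f j ∈ take t (List.tabulate f)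
∈-take-tabulate⁺ f {zero}  (suc t) _         = here refl
∈-take-tabulate⁺ f {suc j} (suc t) (s≤s j<t) = there (∈-take-tabulate⁺ (f ∘ suc) t j<t)

∈-take-tabulate⁻ : ∀ {m} (f : Fin n → Fin m) {x} t → x ∈ take t (List.tabulate f) →
                   ∃[ j ] (toℕ j ℕ.< t × x ≡ f j)
∈-take-tabulate⁻ {n = suc n} f (suc t) (here x≡f0) = zero , s≤s z≤n , x≡f0
∈-take-tabulate⁻ {n = suc n} f (suc t) (there x∈) with ∈-take-tabulate⁻ (f ∘ suc) t x∈
... | j , j<t , x≡fj = suc j , s≤s j<t , x≡fj

∈-calls⁺ : ∀ (σ : Permutation′ n) t {x} → x ∈ˢ called σ t → x ∈ calls σ t
∈-calls⁺ σ t {x} x∈ = reverse⁺ {xs = take t (List.tabulate (σ ⟨$⟩ʳ_))} (subst (_∈ _) (inverseʳ σ)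
  (∈-take-tabulate⁺ (σ ⟨$⟩ʳ_) t (does⇒ (toℕ (σ ⟨$⟩ˡ x) ℕ.<? t)
    (trans (sym (lookup∘tabulate _ x)) ([]=⇒lookup x∈)))))
  where
  does⇒ : ∀ {P : Set} (P? : Dec P) → does P? ≡ true → P
  does⇒ (yes p) _ = p

∈-calls⁻ : ∀ (σ : Permutation′ n) t {x} → x ∈ calls σ t → x ∈ˢ called σ t
∈-calls⁻ σ t {x} x∈ with ∈-take-tabulate⁻ (σ ⟨$⟩ʳ_) t (reverse⁻ {xs = take t (List.tabulate (σ ⟨$⟩ʳ_))} x∈)
... | j , j<t , refl = lookup⇒[]= _ _ (trans (lookup∘tabulate _ x)
  (⇒does (toℕ (σ ⟨$⟩ˡ x) ℕ.<? t) (subst (λ j → toℕ j ℕ.< t) (sym (inverseˡ σ)) j<t)))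
  where
  ⇒does : ∀ {P : Set} (P? : Dec P) → P → does P? ≡ true
  ⇒does (yes _) _ = refl
  ⇒does (no ¬p) p = contradiction p ¬p

calls-suc : ∀ (σ : Permutation′ n) {t} → t ℕ.< n → ∃[ e ] (calls σ (suc t) ≡ e ∷ calls σ t)
calls-suc σ {t} t<n = σ ⟨$⟩ʳ i ,
  subst (λ t → calls σ (suc t) ≡ (σ ⟨$⟩ʳ i) ∷ calls σ t) (toℕ-fromℕ< t<n)
    (trans (cong reverse (take-suc-tabulate (σ ⟨$⟩ʳ_) i))
           (reverse-++ (take (toℕ i) (List.tabulate (σ ⟨$⟩ʳ_))) [ σ ⟨$⟩ʳ i ]))
  where i = fromℕ< t<n

infix 4 _⊑_ _⊑?_

_⊑_ : Subset n → List (Fin n) → Set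
D ⊑ s = ∀ x → x ∈ˢ D → x ∈ s

_⊑?_ : ∀ (D : Subset n) s → Dec (D ⊑ s)
D ⊑? s = all? λ x → (x ∈ˢ? D) →-dec (x ∈? s)

opaque
  unfolding _+_

  /-*-mono : ∀ {a b c} d .{{_ : ℕ.NonZero d}} → a * b ≤ c * c →
             (a ℚ./ d) ℚ.* (b ℚ./ d) ℚ.≤ (c ℚ./ d) ℚ.* (c ℚ./ d)
  /-*-mono {a} {b} {c} (suc d) ab≤cc = ℚ.toℚᵘ-cancel-≤ (begin
    ℚ.toℚᵘ ((a ℚ./ suc d) ℚ.* (b ℚ./ suc d)) ≃⟨ product a b ⟩
    mkℚᵘ a d ℚᵘ.* mkℚᵘ b d
      ≤⟨ *≤* (ℤ.*-monoʳ-≤-nonNeg _ ab≤cc) ⟩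
    mkℚᵘ c d ℚᵘ.* mkℚᵘ c d ≃⟨ ℚᵘ.≃-sym (product c c) ⟩
    ℚ.toℚᵘ ((c ℚ./ suc d) ℚ.* (c ℚ./ suc d)) ∎)
    where
    open ℚᵘ.≤-Reasoning
    product : ∀ a b → ℚ.toℚᵘ ((a ℚ./ suc d) ℚ.* (b ℚ./ suc d)) ℚᵘ.≃ mkℚᵘ a d ℚᵘ.* mkℚᵘ b d
    product a b = ℚᵘ.≃-trans (ℚ.toℚᵘ-homo-* (a ℚ./ suc d) (b ℚ./ suc d))
      (ℚᵘ.*-cong (ℚ.toℚᵘ-fromℚᵘ (mkℚᵘ a d)) (ℚ.toℚᵘ-fromℚᵘ (mkℚᵘ b d)))

≡/⇒log-concave : ∀ {x y z a b c} d .{{_ : ℕ.NonZero d}} →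
  x ≡ a ℚ./ d → y ≡ b ℚ./ d → z ≡ c ℚ./ d → a * b ≤ c * c → x ℚ.* y ℚ.≤ z ℚ.* z
≡/⇒log-concave d refl refl refl = /-*-mono d

0<suc : ∀ k → 0ℤ < Int.+ suc k
0<suc k = Int.+<+ (s≤s z≤n)

0<! : ∀ k → 0ℤ < Int.+ (k !)
0<! k = Int.+<+ (ℕ.1≤n! k)

pos-! : ∀ k → Int.+ (suc k !) ≡ (Int.+ k + 1ℤ) * Int.+ (k !)
pos-! k = trans (pos-* (suc k) (k !)) (cong (_* Int.+ (k !)) (trans (pos-+ 1 k) (+-comm 1ℤ (Int.+ k))))

module _ {n} (M : Matroid n) where

  open Matroid M

  Dependent : List (Fin n) → Set
  Dependent s = ∃[ D ] (Circuit D × D ⊑ s)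

  dependent? : Decidable Dependent
  dependent? s = anySubset? λ D → circuit? D ×-dec (D ⊑? s)

  Independent : List (Fin n) → Set
  Independent s = Unique s × ¬ Dependent s

  independent? : Decidable Independent
  independent? s = unique? s ×-dec ¬? (dependent? s)

  dependent-⊆ : ∀ {s s′} → (∀ {x} → x ∈ s → x ∈ s′) → Dependent s → Dependent s′
  dependent-⊆ s⊆s′ (D , circuit , D⊑s) = D , circuit , λ x x∈D → s⊆s′ (D⊑s x x∈D)

  independent-resp-↭ : ∀ {s s′} → s ↭ s′ → Independent s → Independent s′
  independent-resp-↭ p (u , indep) = Unique-resp-↭ p u , indep ∘ dependent-⊆ (∈-resp-↭ (↭-sym p))

  independent-tail : ∀ {i s} → Independent (i ∷ s) → Independent s
  independent-tail (u , indep) = Unique-tail u , indep ∘ dependent-⊆ there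

  new∈circuit : ∀ {D x s} → Circuit D → D ⊑ x ∷ s → ¬ Dependent s → x ∈ˢ D
  new∈circuit {D} {x} {s} circuit D⊑ indep with x ∈ˢ? D
  ... | yes x∈D = x∈D
  ... | no  x∉D = contradiction (D , circuit , λ y y∈D → strip y∈D (D⊑ y y∈D)) indep
    where
    strip : ∀ {y} → y ∈ˢ D → y ∈ x ∷ s → y ∈ s
    strip y∈D (here refl)  = contradiction y∈D x∉D
    strip y∈D (there y∈s) = y∈s

  two-circuits⇒dependent : ∀ {D₁ D₂ e s} → Circuit D₁ → Circuit D₂ → D₁ ≢ D₂ →
    e ∈ˢ D₁ → e ∈ˢ D₂ → D₁ ⊑ e ∷ s → D₂ ⊑ e ∷ s → Dependent s
  two-circuits⇒dependent {D₁} {D₂} {e} {s} circuit₁ circuit₂ D₁≢D₂ e∈D₁ e∈D₂ D₁⊑ D₂⊑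
    with elimination circuit₁ circuit₂ D₁≢D₂ e∈D₁ e∈D₂
  ... | B , circuit , B⊆ = B , circuit , λ x x∈B → place (B⊆ x∈B)
    where
    place : ∀ {x} → x ∈ˢ (D₁ ∪ D₂) -ˢ e → x ∈ s
    place {x} x∈ with [ D₁⊑ x , D₂⊑ x ]′ (x∈p∪q⁻ D₁ D₂ (p─q⊆p (D₁ ∪ D₂) _ x∈))
    ... | here refl = contradiction x∈ (x∉p-x (D₁ ∪ D₂) x)
    ... | there x∈s = x∈s

  -- If both extensions by `j` are dependent, they contain circuits `D₁` and `D₂` through `j`. Since
  -- `j ∷ s` is independent, `D₁` also passes through `i`, which `D₂` misses. Eliminating `j` leaves
  -- a circuit inside the independent list `i ∷ l ∷ s`.
  exchange : ∀ {i j l s} → Independent (i ∷ l ∷ s) → Independent (j ∷ s) →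
             Independent (j ∷ i ∷ s) ⊎ Independent (j ∷ l ∷ s)
  exchange {i} {j} {l} {s} Iils Ijs with j ≟ i | j ≟ l
  ... | yes refl | _        = inj₂ Iils
  ... | no _     | yes refl = inj₁ (independent-resp-↭ (swap i l ↭-refl) Iils)
  ... | no j≢i   | no j≢l   with dependent? (j ∷ i ∷ s) | dependent? (j ∷ l ∷ s)
  ...   | no indep | _        = inj₁ (Unique-∷ (λ { (here j≡i) → j≢i j≡i ; (there j∈s) → j∉s j∈s }) (proj₁ Iis) , indep)
    where
    j∉s = Unique[x∷xs]⇒x∉xs (proj₁ Ijs)
    Iis = independent-tail (independent-resp-↭ (swap i l ↭-refl) Iils)
  ...   | yes _    | no indep = inj₂ (Unique-∷ (λ { (here j≡l) → j≢l j≡l ; (there j∈s) → j∉s j∈s }) (proj₁ (independent-tail Iils)) , indep)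
    where j∉s = Unique[x∷xs]⇒x∉xs (proj₁ Ijs)
  ...   | yes (D₁ , circuit₁ , D₁⊑) | yes (D₂ , circuit₂ , D₂⊑) =
    contradiction
      (two-circuits⇒dependent circuit₁ circuit₂ D₁≢D₂
        (new∈circuit circuit₁ D₁⊑ (proj₂ Iis)) (new∈circuit circuit₂ D₂⊑ (proj₂ (independent-tail Iils)))
        (λ x x∈ → widen₁ (D₁⊑ x x∈)) (λ x x∈ → widen₂ (D₂⊑ x x∈)))
      (proj₂ Iils)
    where
    Iis = independent-tail (independent-resp-↭ (swap i l ↭-refl) Iils)
    i∈D₁ : i ∈ˢ D₁
    i∈D₁ = new∈circuit circuit₁ (λ x x∈ → ∈-resp-↭ (swap j i ↭-refl) (D₁⊑ x x∈)) (proj₂ Ijs)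
    i∉D₂ : i ∉ˢ D₂
    i∉D₂ i∈D₂ with D₂⊑ i i∈D₂
    ... | here i≡j  = j≢i (sym i≡j)
    ... | there i∈  = Unique[x∷xs]⇒x∉xs (proj₁ Iils) i∈
    D₁≢D₂ : D₁ ≢ D₂
    D₁≢D₂ refl = i∉D₂ i∈D₁
    widen₁ : ∀ {x} → x ∈ j ∷ i ∷ s → x ∈ j ∷ i ∷ l ∷ s
    widen₁ (here p)           = here p
    widen₁ (there (here p))   = there (here p)
    widen₁ (there (there x∈)) = there (there (there x∈))
    widen₂ : ∀ {x} → x ∈ j ∷ l ∷ s → x ∈ j ∷ i ∷ l ∷ s
    widen₂ (here p)   = here p
    widen₂ (there x∈) = there (there x∈)

  open IndependenceSystem independent? independent-resp-↭ independent-tail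
    (λ (u , _) → Unique[x∷xs]⇒x∉xs u (here refl)) exchange public

  φ-setFunction : SetFunction φ
  φ-setFunction = record
    { resp-↭     = F-resp-↭ 0
    ; repetition = λ s ¬u → ⟦⟧-false (independent? s) (¬u ∘ proj₁)
    }

  -- Winning orderings of a fixed circuit

  module _ (C : Subset n) (circuit-C : Circuit C) where

    rest : Fin n → List (Fin n)
    rest e = filter (λ x → (x ∈ˢ? C) ×-dec ¬? (x ≟ e)) (allFin n)

    ∈-rest⁺ : ∀ {e x} → x ∈ˢ C → x ≢ e → x ∈ rest e
    ∈-rest⁺ x∈C x≢e = ∈-filter⁺ _ (∈-allFin _) (x∈C , x≢e)

    ∈-rest⁻ : ∀ {e x} → x ∈ rest e → x ∈ˢ C × x ≢ e
    ∈-rest⁻ {e} {x} x∈ = proj₂ (∈-filter⁻ (λ x → (x ∈ˢ? C) ×-dec ¬? (x ≟ e)) {xs = allFin n} x∈)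

    rest-unique : ∀ e → Unique (rest e)
    rest-unique e = filter⁺ _ (allFin⁺ n)

    ⊑-rest : ∀ {e s} → (∀ {x} → x ∈ rest e → x ∈ s) → C ⊑ e ∷ s
    ⊑-rest {e} rest⊆s x x∈C with x ≟ e
    ... | yes x≡e = here x≡e
    ... | no  x≢e = there (rest⊆s (∈-rest⁺ x∈C x≢e))

    e∷rest-unique : ∀ e → Unique (e ∷ rest e)
    e∷rest-unique e = Unique-∷ (λ e∈ → proj₂ (∈-rest⁻ e∈) refl) (rest-unique e)

    e∷rest-↭ : ∀ {e e′} → e ∈ˢ C → e′ ∈ˢ C → e ∷ rest e ↭ e′ ∷ rest e′
    e∷rest-↭ {e} {e′} e∈C e′∈C = same-members⇒↭ (e∷rest-unique e) (e∷rest-unique e′) (move e∈C) (move e′∈C)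
      where
      move : ∀ {e e′} → e ∈ˢ C → ∀ {x} → x ∈ e ∷ rest e → x ∈ e′ ∷ rest e′
      move e∈C (here refl) = ⊑-rest (λ x∈ → x∈) _ e∈C
      move e∈C (there x∈)  = ⊑-rest (λ x∈ → x∈) _ (proj₁ (∈-rest⁻ x∈))

    ∉-independent : ∀ {e s} → (∀ {x} → x ∈ rest e → x ∈ s) → ¬ Dependent s → e ∉ s
    ∉-independent {e} {s} rest⊆s indep e∈s = indep (C , circuit-C , λ x x∈C → absorb (⊑-rest rest⊆s x x∈C))
      where
      absorb : ∀ {x} → x ∈ e ∷ s → x ∈ s
      absorb (here refl) = e∈s
      absorb (there x∈s) = x∈s

    -- Both sides express independence of `s` in M / C. A circuit inside s ∪ (C - e′) that avoids
    -- `e` lies in s ∪ (C - e). One through `e` differs from C because it misses `e′`, so `e` can be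
    -- eliminated between the two.
    rest-exchange : ∀ {e e′} → e ∈ˢ C → e′ ∈ˢ C → ∀ {s} →
                    Independent (s ++ rest e) → Independent (s ++ rest e′)
    rest-exchange {e} {e′} e∈C e′∈C {s} (u , indep) = Unique-tail e′-unique , indep ∘ transfer
      where
      e-unique : Unique (e ∷ s ++ rest e)
      e-unique = Unique-∷ (∉-independent (∈-++⁺ʳ s) indep) u
      e′-unique : Unique (e′ ∷ s ++ rest e′)
      e′-unique = Unique-resp-↭ (↭-trans (↭-sym (shift e s (rest e)))
        (↭-trans (++⁺ˡ s (e∷rest-↭ e∈C e′∈C)) (shift e′ s (rest e′)))) e-unique
      transfer : Dependent (s ++ rest e′) → Dependent (s ++ rest e)
      transfer (D , circuit-D , D⊑) with e ∈ˢ? D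
      ... | no  e∉D = contradiction (D , circuit-D , λ x x∈D → drop-e x∈D (D⊑′ x x∈D)) indep
        where
        D⊑′ : D ⊑ e ∷ s ++ rest e
        D⊑′ x x∈D with ∈-++⁻ s (D⊑ x x∈D)
        ... | inj₁ x∈s = there (∈-++⁺ˡ x∈s)
        ... | inj₂ x∈r = ⊑-rest (∈-++⁺ʳ s) x (proj₁ (∈-rest⁻ x∈r))
        drop-e : ∀ {x} → x ∈ˢ D → x ∈ e ∷ s ++ rest e → x ∈ s ++ rest e
        drop-e x∈D (here refl) = contradiction x∈D e∉D
        drop-e x∈D (there x∈)  = x∈
      ... | yes e∈D = two-circuits⇒dependent circuit-C circuit-D C≢D e∈C e∈D (⊑-rest (∈-++⁺ʳ s)) D⊑′
        where
        D⊑′ : D ⊑ e ∷ s ++ rest e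
        D⊑′ x x∈D with ∈-++⁻ s (D⊑ x x∈D)
        ... | inj₁ x∈s = there (∈-++⁺ˡ x∈s)
        ... | inj₂ x∈r = ⊑-rest (∈-++⁺ʳ s) x (proj₁ (∈-rest⁻ x∈r))
        C≢D : C ≢ D
        C≢D refl = Unique[x∷xs]⇒x∉xs e′-unique (D⊑ e′ e′∈C)

    F-rest : ∀ {e e′} → e ∈ˢ C → e′ ∈ˢ C → ∀ k → F k (rest e) ≡ F k (rest e′)
    F-rest {e} {e′} e∈C e′∈C k = trans (Φ-++ φ k [] (rest e)) (trans
      (Φ-cong (λ s → ⟦⟧-cong (independent? (s ++ rest e)) (independent? (s ++ rest e′))
                       (rest-exchange e∈C e′∈C {s}) (rest-exchange e′∈C e∈C {s})) k [])
      (sym (Φ-++ φ k [] (rest e′))))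

    length-rest : ∀ {e e′} → e ∈ˢ C → e′ ∈ˢ C → length (rest e) ≡ length (rest e′)
    length-rest e∈C e′∈C = ℕ.suc-injective (↭-length (e∷rest-↭ e∈C e′∈C))

    -- Besides the entries of `s`, also `e` cannot extend `s`, as it would complete C. After all
    -- contractions at most n - |s| - 1 elements remain, which is N + 1.
    rest-bounded : ∀ e k s N → (∀ {x} → x ∈ rest e → x ∈ s) → suc (length s ℕ.+ k) ℕ.+ suc N ≡ n →
                   Bounded (Int.+ N) k s
    rest-bounded e (suc k) s N rest⊆s len i = rest-bounded e k (i ∷ s) N (there ∘ rest⊆s)
      (trans (cong (λ m → suc m ℕ.+ suc N) (sym (ℕ.+-suc (length s) k))) len)
    rest-bounded e zero s N rest⊆s len (u , indep) = ℤ.≤-trans (∑-mono λ i → excluded i (i ∈? (e ∷ s))) (ℤ.≤-reflexive (begin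
      ∑ (λ i → 1ℤ * 1ℤ + -1ℤ * ⟦ i ∈? (e ∷ s) ⟧)
        ≡⟨ ∑-comb 1ℤ -1ℤ (λ _ → 1ℤ) (λ i → ⟦ i ∈? (e ∷ s) ⟧) ⟩
      1ℤ * ∑ (λ (_ : Fin n) → 1ℤ) + -1ℤ * ∑ (λ i → ⟦ i ∈? (e ∷ s) ⟧)
        ≡⟨ cong₂ (λ a b → 1ℤ * a + -1ℤ * b) (trans (∑-1 n) total) (∑-∈ (Unique-∷ e∉s u)) ⟩
      1ℤ * (Int.+ suc (length s) + (1ℤ + Int.+ N)) + -1ℤ * Int.+ suc (length s)
        ≡⟨ eq (Int.+ suc (length s)) (Int.+ N) ⟩
      Int.+ N + 1ℤ ∎))
      where
      open ≡-Reasoning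
      e∉s = ∉-independent rest⊆s indep
      opaque
        unfolding _+_ ring
        eq : ∀ a N → 1ℤ * (a + (1ℤ + N)) + -1ℤ * a ≡ N + 1ℤ
        eq = solve-∀ ring
        one-minus-one : 0ℤ ≡ 1ℤ * 1ℤ + -1ℤ * 1ℤ
        one-minus-one = refl
        one-minus-zero : 1ℤ ≡ 1ℤ * 1ℤ + -1ℤ * 0ℤ
        one-minus-zero = refl
      total : Int.+ n ≡ Int.+ suc (length s) + (1ℤ + Int.+ N)
      total = trans (cong Int.+_ (sym (trans (cong (λ m → suc m ℕ.+ suc N) (sym (ℕ.+-identityʳ (length s)))) len)))
        (trans (pos-+ (suc (length s)) (suc N)) (cong (Int.+ suc (length s) +_) (pos-+ 1 N)))
      excluded : ∀ i (i∈? : Dec (i ∈ e ∷ s)) → φ (i ∷ s) ≤ 1ℤ * 1ℤ + -1ℤ * ⟦ i∈? ⟧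
      excluded i (no _) = subst (φ (i ∷ s) ≤_) one-minus-zero (indicator≤1 (independent? (i ∷ s)))
        where
        indicator≤1 : ∀ {P : Set} (P? : Dec P) → ⟦ P? ⟧ ≤ 1ℤ
        indicator≤1 (yes _) = ℤ.≤-refl
        indicator≤1 (no _)  = Int.+≤+ z≤n
      excluded i (yes i∈) = ℤ.≤-reflexive (trans (⟦⟧-false (independent? (i ∷ s)) (dependent i∈)) one-minus-one)
        where
        dependent : i ∈ e ∷ s → ¬ Independent (i ∷ s)
        dependent (here refl) (_ , indep′) = indep′ (C , circuit-C , ⊑-rest rest⊆s)
        dependent (there i∈s) (u′ , _)     = Unique[x∷xs]⇒x∉xs u′ i∈s

    -- The head is the call of the winning round and the tail holds the calls before it. The value
    -- at `[]` is a default, since a round has at least one call.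
    win : List (Fin n) → ℤ
    win []      = 0ℤ
    win (e ∷ s) = ⟦ (C ⊑? (e ∷ s)) ×-dec ¬? (dependent? s) ⟧

    win-calls : ∀ σ {m} → m ℕ.< n → ⟦ winsInRound? M C (suc m) σ ⟧ ≡ win (calls σ (suc m))
    win-calls σ {m} m<n with calls-suc σ m<n
    ... | e , calls≡ = trans
      (⟦⟧-cong (winsInRound? M C (suc m) σ) ((C ⊑? (e ∷ calls σ m)) ×-dec ¬? (dependent? (calls σ m)))
        (λ (C⊆ , indep) →
          (λ x x∈C → subst (x ∈_) calls≡ (∈-calls⁺ σ (suc m) (C⊆ x∈C))) ,
          λ (D , circuit , D⊑) → indep (D , circuit , λ {x} x∈D → ∈-calls⁻ σ m (D⊑ x x∈D)))
        (λ (C⊑ , indep) →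
          (λ {x} x∈C → ∈-calls⁻ σ (suc m) (subst (x ∈_) (sym calls≡) (C⊑ x x∈C))) ,
          λ (D , circuit , D⊆) → indep (D , circuit , λ x x∈D → ∈-calls⁺ σ m (D⊆ x∈D))))
      (cong win (sym calls≡))

    -- The right side separates the condition on the last call from that on the earlier ones, so
    -- that for each fixed `e` the tails can be counted by `Φ-containing`.
    onUnique-win : ∀ e s → onUnique win (e ∷ s) ≡ ⟦ e ∈ˢ? C ⟧ * containing φ (rest e) s
    onUnique-win e s = trans (⟦⟧-× (unique? (e ∷ s)) win?)
      (trans (⟦⟧-cong (unique? (e ∷ s) ×-dec win?) (e ∈ˢ? C ×-dec (all-contained? (rest e) s ×-dec independent? s)) to from)
             (sym (trans (cong (⟦ e ∈ˢ? C ⟧ *_) (containing-⟦⟧ independent? (rest e) s))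
                         (⟦⟧-× (e ∈ˢ? C) (all-contained? (rest e) s ×-dec independent? s)))))
      where
      win? = (C ⊑? (e ∷ s)) ×-dec ¬? (dependent? s)
      to : Unique (e ∷ s) × (C ⊑ e ∷ s × ¬ Dependent s) →
           e ∈ˢ C × (All (_∈ s) (rest e) × Independent s)
      to (u , C⊑ , indep) = new∈circuit circuit-C C⊑ indep , All.tabulate other , Unique-tail u , indep
        where
        other : ∀ {x} → x ∈ rest e → x ∈ s
        other x∈ with ∈-rest⁻ x∈
        ... | x∈C , x≢e with C⊑ _ x∈C
        ...   | here x≡e  = contradiction x≡e x≢e
        ...   | there x∈s = x∈s
      from : e ∈ˢ C × (All (_∈ s) (rest e) × Independent s) →
             Unique (e ∷ s) × (C ⊑ e ∷ s × ¬ Dependent s)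
      from (e∈C , rest⊆s , u , indep) =
        Unique-∷ (∉-independent (All.lookup rest⊆s) indep) u , ⊑-rest (All.lookup rest⊆s) , indep

    wins : ℕ → ℤ
    wins t = Int.+ length (filter (winsInRound? M C t) (permutations n))

    wins-formula : ∀ m r → suc m ℕ.+ r ≡ n →
      wins (suc m) ≡ Int.+ (r !) * ∑ (λ e → ⟦ e ∈ˢ? C ⟧ * Φ (containing φ (rest e)) m [])
    wins-formula m r len = begin
      wins (suc m)
        ≡⟨ length-filter (winsInRound? M C (suc m)) (permutations n) ⟩
      listSum (λ σ → ⟦ winsInRound? M C (suc m) σ ⟧) (permutations n)
        ≡⟨ listSum-cong (λ σ → win-calls σ (subst (m ℕ.<_) len (s≤s (ℕ.m≤m+n m r)))) (permutations n) ⟩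
      listSum (λ σ → win (calls σ (suc m))) (permutations n)
        ≡⟨ sum-over len win ⟩
      Int.+ (r !) * Φ (onUnique win) (suc m) []
        ≡⟨ cong (Int.+ (r !) *_) (trans (Φ-suc (onUnique win) m [])
             (trans (Φ-cong (λ s → ∑-cong λ e → onUnique-win e s) m [])
               (trans (Φ-∑ (λ e s → ⟦ e ∈ˢ? C ⟧ * containing φ (rest e) s) m [])
                 (∑-cong λ e → Φ-* ⟦ e ∈ˢ? C ⟧ (containing φ (rest e)) m [])))) ⟩
      Int.+ (r !) * ∑ (λ e → ⟦ e ∈ˢ? C ⟧ * Φ (containing φ (rest e)) m []) ∎
      where
      open ≡-Reasoning
      sum-over : ∀ {n} → suc m ℕ.+ r ≡ n → (h : List (Fin n) → ℤ) →
        listSum (λ σ → h (calls σ (suc m))) (permutations n) ≡ Int.+ (r !) * Φ (onUnique h) (suc m) []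
      sum-over refl h = sum-over-permutations (suc m) r h

    module _ {e₀} (e₀∈C : e₀ ∈ˢ C) where

      ℓ : ℕ
      ℓ = length (rest e₀)

      f : ℕ → ℤ
      f k = F k (rest e₀)

      c : ℤ
      c = ∑ λ e → ⟦ e ∈ˢ? C ⟧

      extensions : ℕ → Fin n → ℤ
      extensions m e = Φ (containing φ (rest e)) m []

      rest++[]-unique : ∀ e → Unique (rest e ++ [])
      rest++[]-unique e = subst Unique (sym (++-identityʳ _)) (rest-unique e)

      wins-early : ∀ m r → suc m ℕ.+ r ≡ n → m ℕ.< ℓ → wins (suc m) ≡ 0ℤ
      wins-early m r len m<ℓ = trans (wins-formula m r len)
        (trans (cong (Int.+ (r !) *_) (∑-zero summand)) (*-zeroʳ _))
        where
        summand : ∀ e → ⟦ e ∈ˢ? C ⟧ * extensions m e ≡ 0ℤ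
        summand e with e ∈ˢ? C
        ... | no  _   = *-zeroˡ (extensions m e)
        ... | yes e∈C = trans (*-identityˡ (extensions m e)) (Φ-containing-short φ-setFunction
          (rest e) (rest++[]-unique e)
          (subst (m ℕ.<_) (length-rest e₀∈C e∈C) m<ℓ))

      -- The factor `k !` on the left compensates for `f`, which counts ordered tuples; `c` is |C|,
      -- since each element of C is the last call equally often.
      wins-count : ∀ {m} k r → m ≡ ℓ ℕ.+ k → suc m ℕ.+ r ≡ n →
        wins (suc m) * Int.+ (k !) ≡ Int.+ (r !) * (c * (Int.+ (m !) * f k))
      wins-count {m} k r refl len = begin
        wins (suc m) * Int.+ (k !)
          ≡⟨ cong (_* Int.+ (k !)) (wins-formula m r len) ⟩
        Int.+ (r !) * ∑ (λ e → ⟦ e ∈ˢ? C ⟧ * extensions m e) * Int.+ (k !)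
          ≡⟨ *-assoc _ _ _ ⟩
        Int.+ (r !) * (∑ (λ e → ⟦ e ∈ˢ? C ⟧ * extensions m e) * Int.+ (k !))
          ≡⟨ cong (Int.+ (r !) *_) (trans (∑-* (Int.+ (k !)) _)
               (trans (∑-cong summand) (sym (∑-* (Int.+ (m !) * f k) _)))) ⟩
        Int.+ (r !) * (c * (Int.+ (m !) * f k)) ∎
        where
        open ≡-Reasoning
        summand : ∀ e → ⟦ e ∈ˢ? C ⟧ * extensions m e * Int.+ (k !) ≡ ⟦ e ∈ˢ? C ⟧ * (Int.+ (m !) * f k)
        summand e with e ∈ˢ? C
        ... | no  _   = trans (*-assoc 0ℤ _ _) (trans (*-zeroˡ _) (sym (*-zeroˡ _)))
        ... | yes e∈C = trans (*-assoc 1ℤ _ _) (cong (1ℤ *_) (begin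
          extensions m e * Int.+ (k !)
            ≡⟨ cong (λ l → extensions (l ℕ.+ k) e * Int.+ (k !)) (length-rest e₀∈C e∈C) ⟩
          extensions (length (rest e) ℕ.+ k) e * Int.+ (k !)
            ≡⟨ Φ-containing φ-setFunction (rest e) k (rest++[]-unique e) ⟩
          Int.+ ((length (rest e) ℕ.+ k) !) * F k (rest e ++ [])
            ≡⟨ cong₂ (λ l s → Int.+ ((l ℕ.+ k) !) * F k s)
                 (length-rest e∈C e₀∈C) (++-identityʳ _) ⟩
          Int.+ (m !) * F k (rest e)
            ≡⟨ cong (Int.+ (m !) *_) (F-rest e∈C e₀∈C k) ⟩
          Int.+ (m !) * f k ∎))

      -- Put p = ℓ + k. Mason's factor (o + 2)/(o + 1) cancels against the factorials of the
      -- uncalled elements, and the others leave the ratio (p + 1)(k + 2) / ((p + 2)(k + 1)). It is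
      -- at least 1 since (p + 1)(k + 2) = (p + 2)(k + 1) + ℓ, and the summand ℓ becomes the slack.
      log-concave-from : ∀ k o → suc (suc (suc (ℓ ℕ.+ k))) ℕ.+ o ≡ n →
        wins (suc (ℓ ℕ.+ k)) * wins (suc (suc (suc (ℓ ℕ.+ k)))) ≤
        wins (suc (suc (ℓ ℕ.+ k))) * wins (suc (suc (ℓ ℕ.+ k)))
      log-concave-from k o len = cancel-≤ ((P + 1ℤ) * (K + 1ℤ + 1ℤ)) (0<* (0<+1 (ℓ ℕ.+ k)) (0<+2 k))
        (cancel-≤ ((K + 1ℤ) * (A * A)) (0<* (0<+1 k) (0<* (0<! k) (0<! k)))
          (ℤ.≤-trans (ℤ.≤-trans (ℤ.≤-reflexive left) (mono-≤ Z 0≤Z ulc)) (≤-by _ 0≤slack right)))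
        where
        P = Int.+ (ℓ ℕ.+ k)
        L = Int.+ ℓ
        K = Int.+ k
        O = Int.+ o
        N = O + 1ℤ
        A = Int.+ (k !)
        B = Int.+ (o !)
        G = Int.+ ((ℓ ℕ.+ k) !)
        w₀ = wins (suc (ℓ ℕ.+ k))
        w₁ = wins (suc (suc (ℓ ℕ.+ k)))
        w₂ = wins (suc (suc (suc (ℓ ℕ.+ k))))
        N≡ : Int.+ suc o ≡ N
        N≡ = trans (pos-+ 1 o) (+-comm 1ℤ O)
        suc≡ : ∀ k → Int.+ suc k ≡ Int.+ k + 1ℤ
        suc≡ k = trans (pos-+ 1 k) (+-comm 1ℤ (Int.+ k))
        0<+1 : ∀ k → 0ℤ < Int.+ k + 1ℤ
        0<+1 k = subst (0ℤ <_) (suc≡ k) (0<suc k)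
        0<+2 : ∀ k → 0ℤ < Int.+ k + 1ℤ + 1ℤ
        0<+2 k = subst (0ℤ <_) (trans (suc≡ (suc k)) (cong (_+ 1ℤ) (suc≡ k))) (0<suc (suc k))
        !₂ : ∀ k → Int.+ (suc (suc k) !) ≡ (Int.+ k + 1ℤ + 1ℤ) * ((Int.+ k + 1ℤ) * Int.+ (k !))
        !₂ k = trans (pos-! (suc k)) (cong₂ (λ a b → (a + 1ℤ) * b) (suc≡ k) (pos-! k))
        ulc : (N + 1ℤ) * (f k * f (suc (suc k))) ≤ N * (f (suc k) * f (suc k))
        ulc = subst (λ N → (N + 1ℤ) * (f k * f (suc (suc k))) ≤ N * (f (suc k) * f (suc k))) N≡
          (ultra-log-concave (Int.+ suc o) (0<suc o) k (rest e₀)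
            (rest-bounded e₀ k (rest e₀) (suc o) (λ x∈ → x∈)
              (trans (trans (ℕ.+-suc (suc (ℓ ℕ.+ k)) (suc o)) (ℕ.+-suc (suc (suc (ℓ ℕ.+ k))) o)) len)))
        count₀ : w₀ * A ≡ ((O + 1ℤ + 1ℤ) * ((O + 1ℤ) * B)) * (c * (G * f k))
        count₀ = trans (wins-count k (suc (suc o)) refl
          (trans (trans (ℕ.+-suc (suc (ℓ ℕ.+ k)) (suc o)) (ℕ.+-suc (suc (suc (ℓ ℕ.+ k))) o)) len))
          (cong (_* (c * (G * f k))) (!₂ o))
        count₁ : w₁ * ((K + 1ℤ) * A) ≡ ((O + 1ℤ) * B) * (c * (((P + 1ℤ) * G) * f (suc k)))
        count₁ = begin
          w₁ * ((K + 1ℤ) * A)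
            ≡⟨ cong (w₁ *_) (sym (pos-! k)) ⟩
          w₁ * Int.+ (suc k !)
            ≡⟨ wins-count (suc k) (suc o) (sym (ℕ.+-suc ℓ k)) (trans (ℕ.+-suc (suc (suc (ℓ ℕ.+ k))) o) len) ⟩
          Int.+ (suc o !) * (c * (Int.+ (suc (ℓ ℕ.+ k) !) * f (suc k)))
            ≡⟨ cong₂ (λ a b → a * (c * (b * f (suc k)))) (pos-! o) (pos-! (ℓ ℕ.+ k)) ⟩
          ((O + 1ℤ) * B) * (c * (((P + 1ℤ) * G) * f (suc k))) ∎
          where open ≡-Reasoning
        count₂ : w₂ * ((K + 1ℤ + 1ℤ) * ((K + 1ℤ) * A)) ≡
                 B * (c * (((P + 1ℤ + 1ℤ) * ((P + 1ℤ) * G)) * f (suc (suc k))))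
        count₂ = begin
          w₂ * ((K + 1ℤ + 1ℤ) * ((K + 1ℤ) * A))
            ≡⟨ cong (w₂ *_) (sym (!₂ k)) ⟩
          w₂ * Int.+ (suc (suc k) !)
            ≡⟨ wins-count (suc (suc k)) o (sym (trans (ℕ.+-suc ℓ (suc k)) (cong suc (ℕ.+-suc ℓ k)))) len ⟩
          B * (c * (Int.+ (suc (suc (ℓ ℕ.+ k)) !) * f (suc (suc k))))
            ≡⟨ cong (λ b → B * (c * (b * f (suc (suc k))))) (!₂ (ℓ ℕ.+ k)) ⟩
          B * (c * (((P + 1ℤ + 1ℤ) * ((P + 1ℤ) * G)) * f (suc (suc k)))) ∎
          where open ≡-Reasoning
        -- The multiplier that turns the two sides of Mason's inequality into multiples of w₀ w₂
        -- and, up to the slack, of w₁².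
        Z = (P + 1ℤ) * ((P + 1ℤ) * (P + 1ℤ + 1ℤ)) * (N * ((B * c * G) * (B * c * G)))
        opaque
          unfolding _+_ ring
          e₁ : ∀ p₁ k₁ k₂ a w₀ w₂ → k₁ * (a * a) * (p₁ * k₂ * (w₀ * w₂)) ≡
               p₁ * ((w₀ * a) * (w₂ * (k₂ * (k₁ * a))))
          e₁ = solve-∀ ring
          e₂ : ∀ p₁ p₂ o₁ o₂ b c g x y →
            p₁ * (((o₂ * (o₁ * b)) * (c * (g * x))) * (b * (c * ((p₂ * (p₁ * g)) * y)))) ≡
            p₁ * (p₁ * p₂) * (o₁ * ((b * c * g) * (b * c * g))) * (o₂ * (x * y))
          e₂ = solve-∀ ring
          e₃ : ∀ p₁ p₂ o₁ b c g z →
            p₁ * (p₁ * p₂) * (o₁ * ((b * c * g) * (b * c * g))) * (o₁ * (z * z)) ≡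
            p₂ * (((o₁ * b) * (c * ((p₁ * g) * z))) * ((o₁ * b) * (c * ((p₁ * g) * z))))
          e₃ = solve-∀ ring
          e₄ : ∀ l k → (l + k + 1ℤ) * (k + 1ℤ + 1ℤ) ≡ (l + k + 1ℤ + 1ℤ) * (k + 1ℤ) + l
          e₄ = solve-∀ ring
          e₅ : ∀ p₂ k₁ l a w → k₁ * (a * a) * ((p₂ * k₁ + l) * (w * w)) ≡
            p₂ * ((w * (k₁ * a)) * (w * (k₁ * a))) + k₁ * (a * a) * (l * (w * w))
          e₅ = solve-∀ ring
        left : (K + 1ℤ) * (A * A) * ((P + 1ℤ) * (K + 1ℤ + 1ℤ) * (w₀ * w₂)) ≡
               Z * ((N + 1ℤ) * (f k * f (suc (suc k))))
        left = trans (e₁ (P + 1ℤ) (K + 1ℤ) (K + 1ℤ + 1ℤ) A w₀ w₂) (trans (cong₂ (λ a b → (P + 1ℤ) * (a * b)) count₀ count₂)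
          (e₂ (P + 1ℤ) (P + 1ℤ + 1ℤ) (O + 1ℤ) (O + 1ℤ + 1ℤ) B c G (f k) (f (suc (suc k)))))
        right : (K + 1ℤ) * (A * A) * ((P + 1ℤ) * (K + 1ℤ + 1ℤ) * (w₁ * w₁)) ≡
                Z * (N * (f (suc k) * f (suc k))) + (K + 1ℤ) * (A * A) * (L * (w₁ * w₁))
        right = begin
          (K + 1ℤ) * (A * A) * ((P + 1ℤ) * (K + 1ℤ + 1ℤ) * (w₁ * w₁))
            ≡⟨ cong (λ a → (K + 1ℤ) * (A * A) * (a * (w₁ * w₁))) coefficient ⟩
          (K + 1ℤ) * (A * A) * (((P + 1ℤ + 1ℤ) * (K + 1ℤ) + L) * (w₁ * w₁))
            ≡⟨ e₅ (P + 1ℤ + 1ℤ) (K + 1ℤ) L A w₁ ⟩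
          (P + 1ℤ + 1ℤ) * ((w₁ * ((K + 1ℤ) * A)) * (w₁ * ((K + 1ℤ) * A))) + slack
            ≡⟨ cong (λ a → (P + 1ℤ + 1ℤ) * (a * a) + slack) count₁ ⟩
          (P + 1ℤ + 1ℤ) * (v * v) + slack
            ≡⟨ cong (_+ slack) (sym (e₃ (P + 1ℤ) (P + 1ℤ + 1ℤ) (O + 1ℤ) B c G (f (suc k)))) ⟩
          Z * (N * (f (suc k) * f (suc k))) + slack ∎
          where
          open ≡-Reasoning
          coefficient : (P + 1ℤ) * (K + 1ℤ + 1ℤ) ≡ (P + 1ℤ + 1ℤ) * (K + 1ℤ) + L
          coefficient = subst (λ p → (p + 1ℤ) * (K + 1ℤ + 1ℤ) ≡ (p + 1ℤ + 1ℤ) * (K + 1ℤ) + L)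
            (sym (pos-+ ℓ k)) (e₄ L K)
          slack = (K + 1ℤ) * (A * A) * (L * (w₁ * w₁))
          v = ((O + 1ℤ) * B) * (c * (((P + 1ℤ) * G) * f (suc k)))
        0≤slack : 0ℤ ≤ (K + 1ℤ) * (A * A) * (L * (w₁ * w₁))
        0≤slack = 0≤* (0≤* (ℤ.<⇒≤ (0<+1 k)) (0≤-square A)) (0≤* (Int.+≤+ z≤n) (0≤-square w₁))
        0≤Z : 0ℤ ≤ Z
        0≤Z = 0≤* (0≤* (ℤ.<⇒≤ (0<+1 (ℓ ℕ.+ k))) (0≤* (ℤ.<⇒≤ (0<+1 (ℓ ℕ.+ k))) (ℤ.<⇒≤ (0<+2 (ℓ ℕ.+ k)))))
                  (0≤* (ℤ.<⇒≤ (0<+1 o)) (0≤-square (B * c * G)))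

      wins-log-concave : ∀ p o → suc (suc (suc p)) ℕ.+ o ≡ n →
        wins (suc p) * wins (suc (suc (suc p))) ≤
        wins (suc (suc p)) * wins (suc (suc p))
      wins-log-concave p o len = by-cases (p ℕ.<? ℓ)
        where
        w₁ = wins (suc (suc p))
        w₂ = wins (suc (suc (suc p)))
        late : ∃[ k ] ℓ ℕ.+ k ≡ p → wins (suc p) * w₂ ≤ w₁ * w₁
        late (k , refl) = log-concave-from k o len
        by-cases : Dec (p ℕ.< ℓ) → wins (suc p) * w₂ ≤ w₁ * w₁
        by-cases (no  p≮ℓ) = late (ℕ.m≤n⇒∃[o]m+o≡n (ℕ.≮⇒≥ p≮ℓ))
        -- After p + 1 calls, fewer than |C|, the circuit cannot be complete, so the first factor is
        -- zero.
        by-cases (yes p<ℓ) = subst (_≤ w₁ * w₁) (sym (trans (cong (_* w₂) (wins-early p (suc (suc o))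
          (trans (trans (ℕ.+-suc (suc p) (suc o)) (ℕ.+-suc (suc (suc p)) o)) len) p<ℓ)) (*-zeroˡ w₂))) (0≤-square w₁)

-- From counts to probabilities

β-fraction : ∀ {n} (M : Matroid n) C circuit-C t →
  β M C t ≡ (wins M C circuit-C t ℚ./ length (permutations n)) {{length-permutations≢0 n}}
β-fraction M C circuit-C t = refl

theorem3 : ∀ (n : ℕ) (M : Matroid n) (C : Subset n) →
    Matroid.Circuit M C → LogConcave n (β M C)
theorem3 n M C circuit-C (suc (suc p)) (s≤s (s≤s z≤n)) i≤pred-n =
  ≡/⇒log-concave (length (permutations n)) {{length-permutations≢0 n}}
    (β-fraction M C circuit-C (suc p))
    (β-fraction M C circuit-C (suc (suc (suc p))))
    (β-fraction M C circuit-C (suc (suc p)))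
    (conclude (nonempty? C) (ℕ.m≤n⇒∃[o]m+o≡n (i<n n i≤pred-n)))
  where
  i<n : ∀ n {i} → suc i ℕ.≤ ℕ.pred n → suc i ℕ.< n
  i<n (suc n) i≤n = s≤s i≤n
  conclude : Dec (∃ λ e → e ∈ˢ C) → ∃[ o ] suc (suc (suc p)) ℕ.+ o ≡ n →
    wins M C circuit-C (suc p) * wins M C circuit-C (suc (suc (suc p))) ≤
    wins M C circuit-C (suc (suc p)) * wins M C circuit-C (suc (suc p))
  conclude (yes (e₀ , e₀∈C)) (o , len) = wins-log-concave M C circuit-C e₀∈C p o len
  conclude (no  empty)       _         =
    contradiction (subst (Matroid.Circuit M) (Empty-unique empty) circuit-C) (Matroid.⊥-nonCircuit M)
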